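{- (Extension Theorem) Let $M$ be a Pincherle realiser and let $e_0$ be a Kleene index for the partially computable functional $\Phi(F)=\{e_0\}(F,\mu)$ (with $F$ ranging over type-two functionals). Then, uniformly in $M$, $\Phi$ has a total extension (depending on $M$) that is primitive recursive in $M$ and $\mu$.
   Context: Cantor space $C=2^{\mathbb{N}}$; $\overline{f}n=\langle f(0),\dots,f(n-1)\rangle$; $[\sigma]$ is the set of $g\in C$ extending $\sigma$. $\textsf{LOC}(F,G)$ means $(\forall f,g\in C)[g\in[\overline{f}G(f)]\to F(g)\le G(f)]$. A Pincherle realiser is a type-3 functional $M$ such that for all $F,G:C\to\mathbb{N}$ with $\textsf{LOC}(F,G)$, $F(g)\le M(G)$ for all $g\in C$. $\mu$ is Feferman's functional: $\mu(f)$ is the least $n$ with $f(n)=0$ if such $n$ exists, and $0$ otherwise. $\{e\}(\cdot)$ denotes Kleene computation with index $e$ in the sense of schemes S1–S9; "primitive recursive in" refers to Kleene's higher-type primitive recursion relative to the given functionals. -}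

module Defs where

open import Data.Nat using (ℕ; zero; suc; _+_; _*_; _^_; _∸_; _≤_; _<_)
open import Data.Product using (Σ; _×_; _,_)
open import Data.List using (List; []; _∷_; take)
open import Data.Maybe using (Maybe; just; nothing)
open import Data.Empty using (⊥)
open import Data.Unit using (⊤)
open import Relation.Binary.PropositionalEquality using (_≡_)
open import Relation.Nullary using (¬_)

Ty : ℕ → Set
Ty zero    = ℕ
Ty (suc n) = Ty n → ℕ

Arg : Set
Arg = Σ ℕ Ty

Args : Set
Args = List Arg

-- Kleene indices (schemes S1–S9), as syntax, with an injective
-- numerical coding (needed for S9, which takes an index as a number).

data Code : Set where
  s1 : Code
  s2 : ℕ → Code
  s3 : Code
  s4 : Code → Code → Code
  s5 : Code → Code → Code
  s6 : ℕ → Code → Code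
  s7 : Code
  s8 : Code → Code
  s9 : ℕ → Code

⟪_,_⟫ : ℕ → ℕ → ℕ
⟪ a , b ⟫ = (2 ^ a) * (2 * b + 1) ∸ 1

encode : Code → ℕ
encode s1         = ⟪ 0 , 0 ⟫
encode (s2 q)     = ⟪ 1 , q ⟫
encode s3         = ⟪ 2 , 0 ⟫
encode (s4 c d)   = ⟪ 3 , ⟪ encode c , encode d ⟫ ⟫
encode (s5 c d)   = ⟪ 4 , ⟪ encode c , encode d ⟫ ⟫
encode (s6 i c)   = ⟪ 5 , ⟪ i , encode c ⟫ ⟫
encode s7         = ⟪ 6 , 0 ⟫
encode (s8 c)     = ⟪ 7 , encode c ⟫
encode (s9 m)     = ⟪ 8 , m ⟫

pick : ℕ → Args → Maybe (Arg × Args)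
pick _       []       = nothing
pick zero    (a ∷ as) = just (a , as)
pick (suc i) (a ∷ as) with pick i as
... | nothing        = nothing
... | just (b , bs)  = just (b , a ∷ bs)

-- Kleene computation relation:  Comp c as v  means  {c}(as) = v.

data Comp : Code → Args → ℕ → Set where
  S1 : ∀ {x as} → Comp s1 ((0 , x) ∷ as) (suc x)
  S2 : ∀ {q as} → Comp (s2 q) as q
  S3 : ∀ {x as} → Comp s3 ((0 , x) ∷ as) x
  S4 : ∀ {c d as w v} → Comp d as w → Comp c ((0 , w) ∷ as) v →
       Comp (s4 c d) as v
  S5-0 : ∀ {c d as v} → Comp c as v → Comp (s5 c d) ((0 , zero) ∷ as) v
  S5-s : ∀ {c d x as w v} →
         Comp (s5 c d) ((0 , x) ∷ as) w →
         Comp d ((0 , w) ∷ (0 , x) ∷ as) v →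
         Comp (s5 c d) ((0 , suc x) ∷ as) v
  S6 : ∀ {i c as a rest v} → pick i as ≡ just (a , rest) →
       Comp c (a ∷ rest) v → Comp (s6 i c) as v
  S7 : ∀ {f x as} → Comp s7 ((1 , f) ∷ (0 , x) ∷ as) (f x)
  S8 : ∀ {c k as} {F : Ty (suc (suc k))} (g : Ty (suc k)) →
       (∀ (ξ : Ty k) → Comp c ((suc (suc k) , F) ∷ (k , ξ) ∷ as) (g ξ)) →
       Comp (s8 c) ((suc (suc k) , F) ∷ as) (F g)
  S9 : ∀ {m c as v} → Comp c (take m as) v →
       Comp (s9 m) ((0 , encode c) ∷ as) v

PrimRec : Code → Set
PrimRec s1       = ⊤
PrimRec (s2 _)   = ⊤
PrimRec s3       = ⊤
PrimRec (s4 c d) = PrimRec c × PrimRec d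
PrimRec (s5 c d) = PrimRec c × PrimRec d
PrimRec (s6 _ c) = PrimRec c
PrimRec s7       = ⊤
PrimRec (s8 c)   = PrimRec c
PrimRec (s9 _)   = ⊥

InC : (ℕ → ℕ) → Set
InC f = ∀ n → f n ≤ 1

IsMu : Ty 2 → Set
IsMu μ = (∀ f n → f n ≡ 0 → (f (μ f) ≡ 0) × (μ f ≤ n))
       × (∀ f → (∀ n → ¬ (f n ≡ 0)) → μ f ≡ 0)

Ext : (ℕ → ℕ) → ℕ → (ℕ → ℕ) → Set
Ext f n g = ∀ i → i < n → g i ≡ f i

LOC : Ty 2 → Ty 2 → Set
LOC F G = ∀ f g → InC f → InC g → Ext f (G f) g → F g ≤ G f

Pincherle : Ty 3 → Set
Pincherle M = ∀ (F G : Ty 2) → LOC F G → ∀ g → InC g → F g ≤ M G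

{-# OPTIONS --safe #-}

-- A point f of Cantor space is read as a set of facts about a claimed computation tree of {e₀}(F,μ): which
-- scheme with which arguments sits at a position of the tree, which value it has, and auxiliary facts about
-- codings.  All schemes but S8 give Horn clauses, whose instances mention finitely many facts each.  An S8
-- node is bad if its claimed value is not the oracle's answer to the values claimed for its children, and
-- minimal bad if no node strictly below it is bad.
--
-- Let {e₀}(F,μ) = v.  A set f that satisfies the clauses and has no minimal bad node gives the value v to the
-- root, by induction on the computation.  Any other f differs from the set f₀ of true facts at one of finitely
-- many places that can be read off f: the facts of a violated clause instance, or else, at a minimal bad node,
-- the fact describing the node and the fact giving it the right value.  Let G w n f bound such places if there
-- are any; otherwise let it be n if f gives the value w to the root, and 0 if not.  Then G v n satisfies LOC
-- together with the functional that is n at f₀ and 0 elsewhere, so n ≤ M (G v n) for every n, whereas G w n does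
-- not depend on n if w ≠ v.  Hence v is the least w with n ≤ M (G w n) for all n, and μ finds it.
--
-- Without function extensionality, F and M may distinguish pointwise equal functions; as S8 leaves the choice of
-- the function g open, derivations for the extension are built with suitable choices of g.
module Submission where

open import Defs
open import Data.Bool using (Bool; true; false)
open import Data.Empty using (⊥; ⊥-elim)
open import Data.Fin using (Fin; zero; suc; toℕ; #_; _↑ˡ_; _↑ʳ_)
import Data.List as List
open import Data.List using (List; []; _∷_; _++_; _∷ʳ_; length; InitLast; initLast; _∷ʳ′_)
import Data.List.Properties as List
open import Data.List.Relation.Unary.All as All using (All; []; _∷_)
open import Data.List.Relation.Unary.Any as Any using (Any; here; there)
open import Data.Maybe as Maybe using (Maybe; just; nothing)
open import Data.Maybe.Properties as Maybe using (just-injective)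
open import Data.Nat hiding (parity)
open import Data.Nat.Induction using (<-rec)
open import Data.Nat.Properties
open import Data.Product using (Σ; _×_; _,_; proj₁; proj₂)
open import Data.Sum using (_⊎_; inj₁; inj₂)
open import Data.Unit using (⊤; tt)
open import Data.Vec as Vec using (Vec; []; _∷_; lookup)
open import Data.Vec.Properties using (lookup-++ˡ; lookup-++ʳ)
open import Relation.Binary.PropositionalEquality
open import Relation.Nullary using (¬_; Dec; yes; no; ¬?; decidable-stable)

-- Pairing and list codes

dbl : ℕ → ℕ
dbl zero    = zero
dbl (suc n) = suc (suc (dbl n))

dbl-injective : ∀ m n → dbl m ≡ dbl n → m ≡ n
dbl-injective zero    zero    _ = refl
dbl-injective (suc m) (suc n) p = cong suc (dbl-injective m n (suc-injective (suc-injective p)))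

dbl≢1+dbl : ∀ m n → dbl m ≢ suc (dbl n)
dbl≢1+dbl (suc m) (suc n) p = dbl≢1+dbl m n (suc-injective (suc-injective p))

n≤dbl : ∀ n → n ≤ dbl n
n≤dbl zero    = z≤n
n≤dbl (suc n) = s≤s (m≤n⇒m≤1+n (n≤dbl n))

dbl≡+ : ∀ n → dbl n ≡ n + n
dbl≡+ zero    = refl
dbl≡+ (suc n) = cong suc (trans (cong suc (dbl≡+ n)) (sym (+-suc n n)))

dbl≡2* : ∀ n → dbl n ≡ 2 * n
dbl≡2* n = trans (dbl≡+ n) (cong (n +_) (sym (+-identityʳ n)))

spread : ℕ → ℕ → ℕ
spread zero    b = suc (dbl b)
spread (suc a) b = dbl (spread a b)

spread≡ : ∀ a b → spread a b ≡ 2 ^ a * (2 * b + 1)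
spread≡ zero b = trans (cong suc (dbl≡2* b)) (trans (sym (+-comm (2 * b) 1)) (sym (*-identityˡ _)))
spread≡ (suc a) b = trans (dbl≡2* (spread a b)) (trans (cong (2 *_) (spread≡ a b)) (sym (*-assoc 2 (2 ^ a) _)))

spread-injective : ∀ a b a′ b′ → spread a b ≡ spread a′ b′ → a ≡ a′ × b ≡ b′
spread-injective zero    b zero     b′ p = refl , dbl-injective b b′ (suc-injective p)
spread-injective zero    b (suc a′) b′ p = ⊥-elim (dbl≢1+dbl (spread a′ b′) b (sym p))
spread-injective (suc a) b zero     b′ p = ⊥-elim (dbl≢1+dbl (spread a b) b′ p)
spread-injective (suc a) b (suc a′) b′ p with spread-injective a b a′ b′ (dbl-injective _ _ p)
... | q , r = cong suc q , r

spread>snd : ∀ a b → b < spread a b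
spread>snd zero    b = s≤s (n≤dbl b)
spread>snd (suc a) b = ≤-trans (spread>snd a b) (n≤dbl _)

data Parity : ℕ → Set where
  even : ∀ k → Parity (dbl k)
  odd  : ∀ k → Parity (suc (dbl k))

parity : ∀ n → Parity n
parity zero    = even zero
parity (suc n) with parity n
... | even k = odd k
... | odd k  = even (suc k)

-- For odd `n` the number `suc n` is even, and its half is `suc k` with `k < n`; for even `n` it is
-- odd, and the halving stops.
unspread : ∀ n → Σ ℕ λ a → Σ ℕ λ b → spread a b ≡ suc n
unspread = <-rec Spread step
  where
  Spread : ℕ → Set
  Spread n = Σ ℕ λ a → Σ ℕ λ b → spread a b ≡ suc n
  step : ∀ n → (∀ {m} → m < n → Spread m) → Spread n
  step n ih with parity n
  ... | even k = zero , k , refl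
  ... | odd k with ih {k} (s≤s (n≤dbl k))
  ...   | a , b , p = suc a , b , cong dbl p

-- The pairing function of Defs, kept opaque so that type checking never unfolds it.
opaque
  pair : ℕ → ℕ → ℕ
  pair a b = pred (spread a b)

  pair≡⟪⟫ : ∀ a b → pair a b ≡ ⟪ a , b ⟫
  pair≡⟪⟫ a b = trans (cong pred (spread≡ a b)) (pred[n]≡n∸1 {2 ^ a * (2 * b + 1)})
    where
    pred[n]≡n∸1 : ∀ {n} → pred n ≡ n ∸ 1
    pred[n]≡n∸1 {zero}  = refl
    pred[n]≡n∸1 {suc n} = refl

  pred-spread : ∀ a b → pred (spread a b) ≡ pair a b
  pred-spread a b = refl

  suc-pair : ∀ a b → suc (pair a b) ≡ spread a b
  suc-pair a b with spread a b | spread>snd a b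
  ... | suc _ | _ = refl

  unpair : ℕ → ℕ × ℕ
  unpair n = proj₁ (unspread n) , proj₁ (proj₂ (unspread n))

  pair-unpair : ∀ n → pair (proj₁ (unpair n)) (proj₂ (unpair n)) ≡ n
  pair-unpair n = cong pred (proj₂ (proj₂ (unspread n)))

pair-injective : ∀ {a b a′ b′} → pair a b ≡ pair a′ b′ → a ≡ a′ × b ≡ b′
pair-injective {a} {b} {a′} {b′} p =
  spread-injective a b a′ b′ (trans (sym (suc-pair a b)) (trans (cong suc p) (suc-pair a′ b′)))

unpair-pair : ∀ a b → unpair (pair a b) ≡ (a , b)
unpair-pair a b with pair-injective (pair-unpair (pair a b))
... | p , q = cong₂ _,_ p q

snd≤pair : ∀ a b → b ≤ pair a b
snd≤pair a b = ≤-pred (subst (b <_) (sym (suc-pair a b)) (spread>snd a b))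

-- The successor reserves 0 for the empty list, so `enc` is a bijection and every number is a path
-- or an argument list.
cons : ℕ → ℕ → ℕ
cons a l = suc (pair a l)

enc : List ℕ → ℕ
enc []       = 0
enc (a ∷ as) = cons a (enc as)

enc-injective : ∀ l m → enc l ≡ enc m → l ≡ m
enc-injective []      []      _ = refl
enc-injective (a ∷ l) (b ∷ m) p with pair-injective (suc-injective p)
... | q , r = cong₂ _∷_ q (enc-injective l m r)

enc-surjective : ∀ n → Σ (List ℕ) λ l → enc l ≡ n
enc-surjective = <-rec _ step
  where
  step : ∀ n → (∀ {m} → m < n → Σ (List ℕ) λ l → enc l ≡ m) → Σ (List ℕ) λ l → enc l ≡ n
  step zero    ih = [] , refl
  step (suc n) ih with unpair n | pair-unpair n
  ... | a , b | p with ih {b} (s≤s (subst (b ≤_) p (snd≤pair a b)))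
  ... | l , q = a ∷ l , cong suc (trans (cong (pair a) q) p)

dec : ℕ → List ℕ
dec n = proj₁ (enc-surjective n)

enc-dec : ∀ n → enc (dec n) ≡ n
enc-dec n = proj₂ (enc-surjective n)

dec-enc : ∀ l → dec (enc l) ≡ l
dec-enc l = enc-injective _ l (enc-dec (enc l))

dec-cons : ∀ a n → dec (cons a n) ≡ a ∷ dec n
dec-cons a n = enc-injective _ _ (trans (enc-dec (cons a n)) (cong (cons a) (sym (enc-dec n))))

-- A language for primitive recursive codes

pick-++ : ∀ xs (a : Arg) ys → pick (length xs) (xs ++ a ∷ ys) ≡ just (a , xs ++ ys)
pick-++ []       a ys = refl
pick-++ (x ∷ xs) a ys rewrite pick-++ xs a ys = refl

pick-split : ∀ k zs {a as} → pick k zs ≡ just (a , as) →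
             Σ Args λ xs → Σ Args λ ys → length xs ≡ k × zs ≡ xs ++ a ∷ ys × as ≡ xs ++ ys
pick-split zero    (z ∷ zs) refl = [] , zs , refl , refl , refl
pick-split (suc k) (z ∷ zs) p with pick k zs in eq
pick-split (suc k) (z ∷ zs) refl | just (a , as) with pick-split k zs eq
... | xs , ys , q , r , s = z ∷ xs , ys , cong suc q , cong (z ∷_) r , cong (z ∷_) s

pick-suc : ∀ k z zs {a as} → pick k zs ≡ just (a , as) → pick (suc k) (z ∷ zs) ≡ just (a , z ∷ as)
pick-suc k z zs p rewrite p = refl

rotate : ℕ → ℕ → Code → Code
rotate k zero    c = c
rotate k (suc j) c = s6 k (rotate k j c)

-- S6 only moves arguments to the front; k rotations of the first k + 1 arguments move the front one to place k.
sink : ℕ → Code → Code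
sink k = rotate k k

-- Each S6 moves the last element of `xs` in front of `ys`. After `length xs` steps all of `xs`
-- stands there in its old order, and `a` has come to stand behind both.
rotate-comp : ∀ {c v} a zs j xs ys → length xs ≡ j →
  Comp c (xs ++ ys ++ a ∷ zs) v → Comp (rotate (length (xs ++ ys)) j c) (ys ++ a ∷ xs ++ zs) v
rotate-comp {c} {v} a zs zero    []       ys refl p = p
rotate-comp {c} {v} a zs (suc j) (x ∷ xs) ys e p = go (initLast (x ∷ xs)) e p
  where
  go : ∀ {us} → InitLast us → length us ≡ suc j → Comp c (us ++ ys ++ a ∷ zs) v →
       Comp (rotate (length (us ++ ys)) (suc j) c) (ys ++ a ∷ us ++ zs) v
  go [] () _
  go (us ∷ʳ′ u) e p = S6 {rest = ys ++ a ∷ us ++ zs} pk (subst (λ n → Comp (rotate n j c) (u ∷ ys ++ a ∷ us ++ zs) v) len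
      (rotate-comp a zs j us (u ∷ ys) lus (subst (λ l → Comp c l v) (List.++-assoc us (u ∷ []) _) p)))
    where
    lus : length us ≡ j
    lus = suc-injective (trans (trans (+-comm 1 (length us)) (sym (List.length-++ us))) e)
    len : length (us ++ u ∷ ys) ≡ length ((us ∷ʳ u) ++ ys)
    len = cong length (sym (List.++-assoc us (u ∷ []) ys))
    front : length ((us ∷ʳ u) ++ ys) ≡ length (ys ++ a ∷ us)
    front = trans (sym len) (trans (List.length-++ us) (trans (+-comm (length us) (suc (length ys)))
             (trans (sym (+-suc (length ys) (length us))) (sym (List.length-++ ys)))))
    pk : pick (length ((us ∷ʳ u) ++ ys)) (ys ++ a ∷ (us ∷ʳ u) ++ zs) ≡ just (u , ys ++ a ∷ us ++ zs)
    pk rewrite front | List.++-assoc us (u ∷ []) zs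
             | sym (List.++-assoc ys (a ∷ us) (u ∷ zs)) | sym (List.++-assoc ys (a ∷ us) zs) = pick-++ (ys ++ a ∷ us) u zs

sink-comp : ∀ {k c v zs a as} → pick k zs ≡ just (a , as) → Comp c zs v → Comp (sink k c) (a ∷ as) v
sink-comp {k} {c} {v} {zs} {a} p q with pick-split k zs p
... | xs , ys , refl , refl , refl =
  subst (λ l → Comp (rotate (length l) (length xs) c) (a ∷ xs ++ ys) v) (List.++-identityʳ xs)
        (rotate-comp a ys (length xs) xs [] refl q)

PrimRec-rotate : ∀ k j {c} → PrimRec c → PrimRec (rotate k j c)
PrimRec-rotate k zero    p = p
PrimRec-rotate k (suc j) p = PrimRec-rotate k j p

recℕ : ℕ → ℕ → (ℕ → ℕ → ℕ) → ℕ
recℕ zero    z s = z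
recℕ (suc n) z s = s (recℕ n z s) n

S5-comp : ∀ {c d as z} {s : ℕ → ℕ → ℕ} → Comp c as z →
          (∀ w x → Comp d ((0 , w) ∷ (0 , x) ∷ as) (s w x)) →
          ∀ n → Comp (s5 c d) ((0 , n) ∷ as) (recℕ n z s)
S5-comp p q zero    = S5-0 p
S5-comp p q (suc n) = S5-s (S5-comp p q n) (q _ n)

-- S8 leaves the functional in front of the new argument; c finds it back in its place, under that argument.
call : ℕ → Code → Code
call k c = s6 k (s8 (sink (suc k) c))

call-comp : ∀ {k c zs as t} {X : Ty (2 + t)} → pick k zs ≡ just ((2 + t , X) , as) → (h : Ty (suc t)) →
            (∀ ξ → Comp c ((t , ξ) ∷ zs) (h ξ)) → Comp (call k c) zs (X h)
call-comp {k} {zs = zs} p h q = S6 p (S8 h (λ ξ → sink-comp (pick-suc k _ zs p) (q ξ)))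

PrimRec-call : ∀ k {c} → PrimRec c → PrimRec (call k c)
PrimRec-call k p = PrimRec-rotate (suc k) (suc k) p

stack : ∀ {n} → Vec ℕ n → Args → Args
stack []      T = T
stack (x ∷ ρ) T = (0 , x) ∷ stack ρ T

pick-stack : ∀ {n} (ρ : Vec ℕ n) k {T a T′} → pick k T ≡ just (a , T′) → pick (n + k) (stack ρ T) ≡ just (a , stack ρ T′)
pick-stack []      k p = p
pick-stack {suc n} (x ∷ ρ) k {T} p rewrite pick-stack ρ k {T} p = refl

pick-lookup : ∀ {n} (ρ : Vec ℕ n) i T → Σ Args λ as → pick (toℕ i) (stack ρ T) ≡ just ((0 , lookup ρ i) , as)
pick-lookup (x ∷ ρ) zero    T = stack ρ T , refl
pick-lookup (x ∷ ρ) (suc i) T with pick-lookup ρ i T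
... | as , p = _ , pick-suc (toℕ i) _ (stack ρ T) p

-- Expressions over n number variables, compiled to primitive recursive codes acting on the arguments
-- stack ρ (f ∷ F ∷ M ∷ μ ∷ []) for b = true and stack ρ (F ∷ M ∷ μ ∷ []) for b = false.
-- In orc t e the subexpression t is not executed: it only selects a representative of the pointwise
-- equality class of e.  The constructor box stands for a computation that calls M.
data Exp : Bool → ℕ → Set where
  var : ∀ {b n} → Fin n → Exp b n
  lit : ∀ {b n} → ℕ → Exp b n
  sc  : ∀ {b n} → Exp b n → Exp b n
  pr  : ∀ {b n} → Exp b n → Exp b n → Exp b n
  rec : ∀ {b n} → Exp b n → Exp b n → Exp b (2 + n) → Exp b n
  lt  : ∀ {b n} → Exp b n → Exp b (suc n) → Exp b n
  mu  : ∀ {b n} → Exp b (suc n) → Exp b n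
  qry : ∀ {n} → Exp true n → Exp true n
  orc : ∀ {n} → Exp true n → Exp true (suc n) → Exp true n
  box : Exp false 2

dblCode : Code
dblCode = s5 (s2 0) (s4 s1 s1)

dblCode-comp : ∀ n {as} → Comp dblCode ((0 , n) ∷ as) (dbl n)
dblCode-comp zero    = S5-0 S2
dblCode-comp (suc n) = S5-s (dblCode-comp n) (S4 S1 S1)

spreadCode-comp : ∀ {c as} a {b} → Comp c as b →
                  Comp (s5 (s4 (s4 s1 dblCode) c) dblCode) ((0 , a) ∷ as) (spread a b)
spreadCode-comp zero    p = S5-0 (S4 p (S4 (dblCode-comp _) S1))
spreadCode-comp (suc a) p = S5-s (spreadCode-comp a p) (dblCode-comp _)

predCode-comp : ∀ n {as} → Comp (s5 (s2 0) (s6 1 s3)) ((0 , n) ∷ as) (pred n)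
predCode-comp zero    = S5-0 S2
predCode-comp (suc n) = S5-s (predCode-comp n) (S6 refl S3)

pairCode : Code → Code → Code
pairCode a b = s4 (s5 (s2 0) (s6 1 s3)) (s4 (s5 (s4 (s4 s1 dblCode) b) dblCode) a)

pairCode-comp : ∀ {c d as a b} → Comp c as a → Comp d as b → Comp (pairCode c d) as (pair a b)
pairCode-comp {a = a} {b} p q =
  S4 (S4 p (spreadCode-comp a q)) (subst (Comp _ _) (pred-spread a b) (predCode-comp (spread a b)))

placeμ : Bool → ℕ
placeμ true  = 3
placeμ false = 2

compile : ∀ {b n} → Code → Exp b n → Code
compile κ (var i)     = s6 (toℕ i) s3
compile κ (lit k)     = s2 k
compile κ (sc e)      = s4 s1 (compile κ e)
compile κ (pr e e′)   = pairCode (compile κ e) (compile κ e′)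
compile κ (rec e z s) = s4 (s5 (compile κ z) (compile κ s)) (compile κ e)
compile κ (lt e e′)   = s4 (compile κ e′) (compile κ e)
compile {b} {n} κ (mu e) = call (n + placeμ b) (compile κ e)
compile {n = n} κ (qry e) = s4 (s6 (suc n + 0) s7) (compile κ e)
compile {n = n} κ (orc t e) = call (n + 1) (compile κ e)
compile κ box         = κ

compile-PrimRec : ∀ {b n κ} → PrimRec κ → (e : Exp b n) → PrimRec (compile κ e)
compile-PrimRec p (var i)     = tt
compile-PrimRec p (lit k)     = tt
compile-PrimRec p (sc e)      = tt , compile-PrimRec p e
compile-PrimRec p (pr e e′)   = (tt , tt) , ((((tt , (tt , tt , tt)) , compile-PrimRec p e′) , (tt , tt , tt)) , compile-PrimRec p e)
compile-PrimRec p (rec e z s) = (compile-PrimRec p z , compile-PrimRec p s) , compile-PrimRec p e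
compile-PrimRec p (lt e e′)   = compile-PrimRec p e′ , compile-PrimRec p e
compile-PrimRec {b} {n} {κ} p (mu e) = PrimRec-call (n + placeμ b) {compile κ e} (compile-PrimRec p e)
compile-PrimRec p (qry e)     = tt , compile-PrimRec p e
compile-PrimRec {n = n} {κ} p (orc t e) = PrimRec-call (n + 1) {compile κ e} (compile-PrimRec p e)
compile-PrimRec p box         = p

-- Evaluation of expressions and soundness of compilation

module Semantics (μ F : Ty 2) (choose : ℕ → Ty 1 → Ty 1) where

  -- What an expression is evaluated against: the queried set `f`, or the values `B n w` returned by
  -- the calls of `M`.
  Sem : Bool → Set
  Sem true  = Ty 1
  Sem false = ℕ → ℕ → ℕ

  eval : ∀ {b n} → Exp b n → Sem b → Vec ℕ n → ℕ
  eval (var i)     σ ρ = lookup ρ i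
  eval (lit k)     σ ρ = k
  eval (sc e)      σ ρ = suc (eval e σ ρ)
  eval (pr e e′)   σ ρ = pair (eval e σ ρ) (eval e′ σ ρ)
  eval (rec e z s) σ ρ = recℕ (eval e σ ρ) (eval z σ ρ) (λ w x → eval s σ (w ∷ x ∷ ρ))
  eval (lt e e′)   σ ρ = eval e′ σ (eval e σ ρ ∷ ρ)
  eval (mu e)      σ ρ = μ (λ x → eval e σ (x ∷ ρ))
  eval (qry e)     f ρ = f (eval e f ρ)
  eval (orc t e)   f ρ = F (choose (eval t f ρ) (λ x → eval e f (x ∷ ρ)))
  eval box         B (n ∷ w ∷ []) = B n w

  module Soundness (M : Ty 3) (choose-≗ : ∀ s h → choose s h ≗ h) where

    functionals : ∀ b → Sem b → Args
    functionals true  f = (1 , f) ∷ (2 , F) ∷ (3 , M) ∷ (2 , μ) ∷ []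
    functionals false B = (2 , F) ∷ (3 , M) ∷ (2 , μ) ∷ []

    BoxSpec : ∀ b → Code → Sem b → Set
    BoxSpec true  κ f = ⊤
    BoxSpec false κ B = ∀ n w → Comp κ (stack (n ∷ w ∷ []) (functionals false B)) (B n w)

    pick-μ : ∀ b σ → Σ Args λ T → pick (placeμ b) (functionals b σ) ≡ just ((2 , μ) , T)
    pick-μ true  σ = _ , refl
    pick-μ false σ = _ , refl

    -- S8 accepts any function with the computed values, so at `orc` the derivation takes the
    -- representative picked by `choose`.
    sound : ∀ {b n κ} σ → BoxSpec b κ σ → (e : Exp b n) (ρ : Vec ℕ n) →
            Comp (compile κ e) (stack ρ (functionals b σ)) (eval e σ ρ)
    sound {b} σ bx (var i) ρ = S6 (proj₂ (pick-lookup ρ i (functionals b σ))) S3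
    sound σ bx (lit k) ρ = S2
    sound σ bx (sc e) ρ = S4 (sound σ bx e ρ) S1
    sound σ bx (pr e e′) ρ = pairCode-comp (sound σ bx e ρ) (sound σ bx e′ ρ)
    sound σ bx (rec e z s) ρ = S4 (sound σ bx e ρ)
      (S5-comp (sound σ bx z ρ) (λ w x → sound σ bx s (w ∷ x ∷ ρ)) (eval e σ ρ))
    sound σ bx (lt e e′) ρ = S4 (sound σ bx e ρ) (sound σ bx e′ (eval e σ ρ ∷ ρ))
    sound {b} σ bx (mu e) ρ =
      call-comp (pick-stack ρ (placeμ b) (proj₂ (pick-μ b σ))) _ (λ x → sound σ bx e (x ∷ ρ))
    sound f bx (qry e) ρ = S4 (sound f bx e ρ) (S6 (pick-stack (eval e f ρ ∷ ρ) 0 refl) S7)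
    sound f bx (orc t e) ρ = call-comp (pick-stack ρ 1 refl) _
      (λ x → subst (Comp _ _) (sym (choose-≗ (eval t f ρ) _ x)) (sound f bx e (x ∷ ρ)))
    sound B bx box (n ∷ w ∷ []) = bx n w

-- Clauses and the bounding functional

-- As formulas, expressions are true when their value is 0.

predE : ∀ {b n} → Exp b n → Exp b n
predE e = rec e (lit 0) (var (# 1))

-- Truncated subtraction by iterated predecessor, which is 0 exactly when the inequality holds.
-- Likewise `andE` is addition.
leE : ∀ {b n} → Exp b n → Exp b n → Exp b n
leE a c = rec c a (predE (var (# 0)))

andE : ∀ {b n} → Exp b n → Exp b n → Exp b n
andE a c = rec a c (sc (var (# 0)))

notE : ∀ {b n} → Exp b n → Exp b n
notE a = rec a (lit 1) (lit 0)

orE : ∀ {b n} → Exp b n → Exp b n → Exp b n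
orE a c = notE (andE (notE a) (notE c))

neE : ∀ {b n} → Exp b n → Exp b n → Exp b n
neE a c = notE (andE (leE a c) (leE c a))

-- If `e` has a zero then `μ` finds one, so testing `e` at the answer of `μ` decides the quantifier.
exE : ∀ {b n} → Exp b (suc n) → Exp b n
exE e = lt (mu e) e

opaque
  exsE : ∀ {b n} k → Exp b (k + n) → Exp b n
  exsE zero    e = e
  exsE (suc k) e = exsE k (exE e)

recℕ-le : ∀ a c → recℕ c a (λ w _ → recℕ w 0 (λ _ x → x)) ≡ a ∸ c
recℕ-le a zero    = refl
recℕ-le a (suc c) rewrite recℕ-le a c = trans (recℕ-pred (a ∸ c)) (pred[m∸n]≡m∸[1+n] a c)
  where
  recℕ-pred : ∀ w → recℕ w 0 (λ _ x → x) ≡ pred w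
  recℕ-pred zero    = refl
  recℕ-pred (suc w) = refl

recℕ-and : ∀ a c → recℕ a c (λ w _ → suc w) ≡ a + c
recℕ-and zero    c = refl
recℕ-and (suc a) c = cong suc (recℕ-and a c)

-- Terms without queries: which facts a clause instance mentions depends on the assignment only, not
-- on `f`.
data Tm (n : ℕ) : Set where
  var : Fin n → Tm n
  lit : ℕ → Tm n
  sc  : Tm n → Tm n
  pr  : Tm n → Tm n → Tm n

tm : ∀ {n} → Tm n → Vec ℕ n → ℕ
tm (var i)  ρ = lookup ρ i
tm (lit k)  ρ = k
tm (sc t)   ρ = suc (tm t ρ)
tm (pr t u) ρ = pair (tm t ρ) (tm u ρ)

record Rule : Set where
  constructor rule
  field
    ins : List (Tm 6)
    nes : List (Tm 6 × Tm 6)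
    out : Maybe (Tm 6)

infix 4 _∈ᶠ_
_∈ᶠ_ : ℕ → (ℕ → ℕ) → Set
a ∈ᶠ f = f a ≡ 0

OutIn : ∀ {n} → (ℕ → ℕ) → Maybe (Tm n) → Vec ℕ n → Set
OutIn f nothing  ρ = ⊥
OutIn f (just t) ρ = tm t ρ ∈ᶠ f

Holds : (ℕ → ℕ) → Rule → Set
Holds f (rule ins nes out) = (ρ : Vec ℕ 6) → All (λ t → tm t ρ ∈ᶠ f) ins →
  All (λ p → tm (proj₁ p) ρ ≢ tm (proj₂ p) ρ) nes → OutIn f out ρ

-- Facts have the form pair (pair k x) y: the value of table k at x is y.  The tables are 0 (the tuple at a
-- position, with 0 for unused positions), 1 (the value at a position), 2 (the shape of a tuple), 3 (pick),
-- 4 (take) and 5 (whether a position is strictly below another one).  The root is at position 0, and child i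
-- of s is at cons i s, so that positions are codes of paths.
atT : ∀ {n} → ℕ → Tm n → Tm n → Tm n
atT k x y = pr (pr (lit k) x) y

consT : ∀ {n} → Tm n → Tm n → Tm n
consT a l = sc (pr a l)

-- Shifted by two because the argument codes 0 and 1 are taken by `F` and `μ`.
numT : ∀ {n} → Tm n → Tm n
numT t = sc (sc t)

-- Kinds of nodes: a leaf has its value at once; a tail node takes over the value of its child `y`;
-- a bind node evaluates `y` and then runs `c` with the value of `y` as a new first argument.
leafT : ∀ {n} → Tm n → Tm n
leafT v = pr (lit 0) v

tailT : ∀ {n} → Tm n → Tm n
tailT y = pr (lit 1) y

bindT : ∀ {n} → Tm n → Tm n → Tm n → Tm n
bindT y c as = pr (lit 2) (pr y (pr c as))

x₀ x₁ x₂ x₃ x₄ x₅ : Tm 6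
x₀ = var (# 0)
x₁ = var (# 1)
x₂ = var (# 2)
x₃ = var (# 3)
x₄ = var (# 4)
x₅ = var (# 5)

opT : ∀ {n} → ℕ → Tm n → Tm n
opT k a = pr (lit k) a

rules : ℕ → List Rule
rules x =
    -- The one clause concluding falsity: a table has at most one value at each place.
    rule (pr x₀ x₁ ∷ pr x₀ x₂ ∷ []) ((x₁ , x₂) ∷ []) nothing
  ∷ rule [] [] (just (atT 0 (lit 0) (lit x)))
  -- Shapes for S1 to S6 and S9. S7 cannot occur, since no argument has type 1, and S8 nodes are
  -- read off their tuples.
  ∷ rule [] [] (just (atT 2 (pr (opT 0 x₂) (consT (numT x₀) x₁)) (leafT (sc x₀))))
  ∷ rule [] [] (just (atT 2 (pr (opT 1 x₀) x₁) (leafT x₀)))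
  ∷ rule [] [] (just (atT 2 (pr (opT 2 x₂) (consT (numT x₀) x₁)) (leafT x₀)))
  ∷ rule [] [] (just (atT 2 (pr (opT 3 (pr x₀ x₁)) x₂) (bindT (pr x₁ x₂) x₀ x₂)))
  ∷ rule [] [] (just (atT 2 (pr (opT 4 (pr x₀ x₁)) (consT (numT (lit 0)) x₂)) (tailT (pr x₀ x₂))))
  ∷ rule [] [] (just (atT 2 (pr (opT 4 (pr x₀ x₁)) (consT (numT (sc x₂)) x₃))
                          (bindT (pr (opT 4 (pr x₀ x₁)) (consT (numT x₂) x₃)) x₁ (consT (numT x₂) x₃))))
  ∷ rule (atT 3 (pr x₀ x₁) x₂ ∷ []) [] (just (atT 2 (pr (opT 5 (pr x₀ x₃)) x₁) (tailT (pr x₃ x₂))))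
  ∷ rule (atT 4 (pr x₀ x₁) x₂ ∷ []) [] (just (atT 2 (pr (opT 8 x₀) (consT (numT x₃) x₁)) (tailT (pr x₃ x₂))))
  ∷ rule [] [] (just (atT 3 (pr (lit 0) (consT x₀ x₁)) (consT x₀ x₁)))
  ∷ rule (atT 3 (pr x₀ x₁) (consT x₂ x₃) ∷ []) []
      (just (atT 3 (pr (sc x₀) (consT x₄ x₁)) (consT x₂ (consT x₄ x₃))))
  ∷ rule [] [] (just (atT 4 (pr (lit 0) x₀) (lit 0)))
  ∷ rule [] [] (just (atT 4 (pr x₀ (lit 0)) (lit 0)))
  ∷ rule (atT 4 (pr x₀ x₁) x₂ ∷ []) [] (just (atT 4 (pr (sc x₀) (consT x₃ x₁)) (consT x₃ x₂)))
  ∷ rule (atT 0 x₀ x₁ ∷ atT 2 x₁ (leafT x₂) ∷ []) [] (just (atT 1 x₀ x₂))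
  ∷ rule (atT 0 x₀ x₁ ∷ atT 2 x₁ (leafT x₂) ∷ []) [] (just (atT 0 (consT x₃ x₀) (lit 0)))
  ∷ rule (atT 0 x₀ x₁ ∷ atT 2 x₁ (tailT x₂) ∷ []) [] (just (atT 0 (consT (lit 0) x₀) x₂))
  ∷ rule (atT 0 x₀ x₁ ∷ atT 2 x₁ (tailT x₂) ∷ atT 1 (consT (lit 0) x₀) x₃ ∷ []) [] (just (atT 1 x₀ x₃))
  ∷ rule (atT 0 x₀ x₁ ∷ atT 2 x₁ (tailT x₂) ∷ []) [] (just (atT 0 (consT (sc x₃) x₀) (lit 0)))
  ∷ rule (atT 0 x₀ x₁ ∷ atT 2 x₁ (bindT x₂ x₃ x₄) ∷ []) [] (just (atT 0 (consT (lit 0) x₀) x₂))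
  ∷ rule (atT 0 x₀ x₁ ∷ atT 2 x₁ (bindT x₂ x₃ x₄) ∷ atT 1 (consT (lit 0) x₀) x₅ ∷ []) []
      (just (atT 0 (consT (lit 1) x₀) (pr x₃ (consT (numT x₅) x₄))))
  ∷ rule (atT 0 x₀ x₁ ∷ atT 2 x₁ (bindT x₂ x₃ x₄) ∷ atT 1 (consT (lit 1) x₀) x₅ ∷ []) [] (just (atT 1 x₀ x₅))
  ∷ rule (atT 0 x₀ x₁ ∷ atT 2 x₁ (bindT x₂ x₃ x₄) ∷ []) [] (just (atT 0 (consT (sc (sc x₅)) x₀) (lit 0)))
  -- An S8 node has a child for every number, with that number inserted behind the oracle. No clause
  -- governs the value of the node.
  ∷ rule (atT 0 x₀ (pr (opT 7 x₁) (consT x₂ x₃)) ∷ []) []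
      (just (atT 0 (consT x₄ x₀) (pr x₁ (consT x₂ (consT (numT x₄) x₃)))))
  ∷ rule (atT 0 x₀ (lit 0) ∷ []) [] (just (atT 0 (consT x₁ x₀) (lit 0)))
  ∷ rule [] [] (just (atT 5 (pr (lit 0) x₀) (lit 0)))
  ∷ rule [] [] (just (atT 5 (pr (consT x₀ x₁) x₁) (lit 1)))
  -- The side condition separates this clause from the preceding one, which would otherwise
  -- contradict it at a child of `x₁`.
  ∷ rule (atT 5 (pr x₀ x₁) x₂ ∷ []) ((x₀ , x₁) ∷ []) (just (atT 5 (pr (consT x₃ x₀) x₁) x₂))
  ∷ []

emb : ∀ {k n} → Tm k → Exp true (k + n)
emb {n = n} (var i) = var (i ↑ˡ n)
emb (lit k)  = lit k
emb (sc t)   = sc (emb t)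
emb (pr t u) = pr (emb t) (emb u)

-- The variable following those of the rule is a strict bound for the facts that the violated instance mentions.
atomE : ∀ {k n} → Tm k → Exp true (k + suc n) → Exp true (k + suc n)
atomE {k} t e = andE (leE (sc (emb t)) (var (k ↑ʳ zero))) e

insE : ∀ {k n} → List (Tm k) → Exp true (k + suc n) → Exp true (k + suc n)
insE []       e = e
insE (t ∷ ts) e = andE (atomE t (qry (emb t))) (insE ts e)

nesE : ∀ {k n} → List (Tm k × Tm k) → Exp true (k + suc n) → Exp true (k + suc n)
nesE []             e = e
nesE ((t , u) ∷ ps) e = andE (neE (emb t) (emb u)) (nesE ps e)

outE : ∀ {k n} → Maybe (Tm k) → Exp true (k + suc n)
outE nothing  = lit 0
outE (just t) = atomE t (notE (qry (emb t)))

violatedE : ∀ {n} → Rule → Exp true (suc n)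
violatedE (rule ins nes out) = exsE 6 (insE ins (nesE nes (outE out)))

violationE : ∀ {n} → List Rule → Exp true (suc n)
violationE []       = lit 1
violationE (r ∷ rs) = orE (violatedE r) (violationE rs)

-- In callE, answerE and badE the variables 0, 1, 2, 3 are the remaining arguments, the index, the oracle and the
-- position of an S8 node; childValueE is also used under the two extra variables of rec.
childValueE : ∀ {n} → Fin n → Exp true (suc n)
childValueE s = mu (qry (pr (pr (lit 1) (sc (pr (var (# 1)) (var (suc (suc s)))))) (var (# 0))))

callE : ∀ {n} → Exp true (4 + n)
callE = pr (pr (lit 0) (var (# 3))) (pr (pr (lit 7) (var (# 1))) (sc (pr (var (# 2)) (var (# 0)))))

answerE : ∀ {n} → Exp true (4 + n)
answerE = pr (pr (lit 1) (var (# 3)))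
  (rec (var (# 2)) (orc (var (# 3)) (childValueE (# 3))) (mu (childValueE (# 5))))

badE : ∀ {n} → Exp true (4 + n)
badE = andE (qry callE) (notE (qry answerE))

-- The position quantified here becomes variable 3 of `badE` under the three inner quantifiers.
badBelowE : ∀ {n} → Exp true (4 + n)
badBelowE = exE (andE (qry (pr (pr (lit 5) (pr (var (# 0)) (var (# 4)))) (lit 1))) (exsE 3 badE))

minBadE : ∀ {n} → Exp true (suc n)
minBadE = exsE 4 (andE (andE badE (notE badBelowE))
                       (andE (leE (sc callE) (var (# 4))) (leE (sc answerE) (var (# 4)))))

-- Violations take precedence since the refutation of a minimal bad node uses all clauses.
opaque
  errorE : ∀ {n} → List Rule → Exp true (suc n)
  errorE rs = orE (violationE rs) (andE (notE (exE (violationE rs))) minBadE)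

-- The variables 0 and 1 are n and w in the notation G w n.
modulusE : List Rule → Exp true 2
modulusE rs = lt (mu (errorE rs)) (rec (errorE rs) (var (# 0))
  -- `rec` serves as a case distinction at zero. Under its two variables and the one bound by `lt`,
  -- the variables 3 and 4 are `n` and `w`.
  (rec (qry (pr (pr (lit 1) (lit 0)) (var (# 4)))) (var (# 3)) (lit 0)))

-- Inside the quantifier variable 0 is `n` and variable 1 is `w`, as `box` expects. The search is
-- for the least `w` at which no `n` exceeds the value of `M`.
leastE : Exp false 0
leastE = mu (notE (exE (leE (sc box) (var (# 0)))))

-- Truth of formulas and violated clauses

module Truth (μ : Ty 2) (isμ : IsMu μ) (F : Ty 2) (choose : ℕ → Ty 1 → Ty 1) where
  open Semantics μ F choose

  record True {b n} (e : Exp b n) (σ : Sem b) (ρ : Vec ℕ n) : Set where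
    constructor by
    field isTrue : eval e σ ρ ≡ 0
  open True public

  module _ {b : Bool} {n : ℕ} {σ : Sem b} {ρ : Vec ℕ n} where

    le⇒ : ∀ (e e′ : Exp b n) → True (leE e e′) σ ρ → eval e σ ρ ≤ eval e′ σ ρ
    le⇒ e e′ (by p) = m∸n≡0⇒m≤n (trans (sym (recℕ-le (eval e σ ρ) (eval e′ σ ρ))) p)

    ⇒le : ∀ (e e′ : Exp b n) → eval e σ ρ ≤ eval e′ σ ρ → True (leE e e′) σ ρ
    ⇒le e e′ p = by (trans (recℕ-le (eval e σ ρ) (eval e′ σ ρ)) (m≤n⇒m∸n≡0 p))

    and⇒ : ∀ (e e′ : Exp b n) → True (andE e e′) σ ρ → True e σ ρ × True e′ σ ρ
    and⇒ e e′ (by p) with trans (sym (recℕ-and (eval e σ ρ) (eval e′ σ ρ))) p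
    ... | q = by (m+n≡0⇒m≡0 (eval e σ ρ) q) , by (m+n≡0⇒n≡0 (eval e σ ρ) q)

    ⇒and : ∀ (e e′ : Exp b n) → True e σ ρ × True e′ σ ρ → True (andE e e′) σ ρ
    ⇒and e e′ (by p , by q) = by (trans (recℕ-and (eval e σ ρ) (eval e′ σ ρ)) (cong₂ _+_ p q))

    not⇒ : ∀ (e : Exp b n) → True (notE e) σ ρ → ¬ True e σ ρ
    not⇒ e (by p) (by q) with eval e σ ρ
    not⇒ e (by ()) (by refl) | zero

    ⇒not : ∀ (e : Exp b n) → ¬ True e σ ρ → True (notE e) σ ρ
    ⇒not e p = by (negate (λ q → p (by q)))
      where
      negate : ¬ (eval e σ ρ ≡ 0) → eval (notE e) σ ρ ≡ 0
      negate with eval e σ ρ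
      ... | zero  = λ p → ⊥-elim (p refl)
      ... | suc _ = λ _ → refl

    or⇒ : ∀ (e e′ : Exp b n) → True (orE e e′) σ ρ → True e σ ρ ⊎ True e′ σ ρ
    or⇒ e e′ p with eval e σ ρ ≟ 0 | eval e′ σ ρ ≟ 0
    ... | yes q | _     = inj₁ (by q)
    ... | no _  | yes r = inj₂ (by r)
    ... | no q  | no r  = ⊥-elim (not⇒ (andE (notE e) (notE e′)) p (⇒and (notE e) (notE e′) (⇒not e (λ s → q (isTrue s)) , ⇒not e′ (λ s → r (isTrue s)))))

    ⇒or : ∀ (e e′ : Exp b n) → True e σ ρ ⊎ True e′ σ ρ → True (orE e e′) σ ρ
    ⇒or e e′ p = ⇒not (andE (notE e) (notE e′)) (λ q → refute p (and⇒ (notE e) (notE e′) q))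
      where
      refute : True e σ ρ ⊎ True e′ σ ρ → ¬ (True (notE e) σ ρ × True (notE e′) σ ρ)
      refute (inj₁ p) (q , _) = not⇒ e q p
      refute (inj₂ p) (_ , q) = not⇒ e′ q p

    ne⇒ : ∀ (e e′ : Exp b n) → True (neE e e′) σ ρ → eval e σ ρ ≢ eval e′ σ ρ
    ne⇒ e e′ p q = not⇒ (andE (leE e e′) (leE e′ e)) p
      (⇒and (leE e e′) (leE e′ e) (⇒le e e′ (≤-reflexive q) , ⇒le e′ e (≤-reflexive (sym q))))

    ⇒ne : ∀ (e e′ : Exp b n) → eval e σ ρ ≢ eval e′ σ ρ → True (neE e e′) σ ρ
    ⇒ne e e′ p = ⇒not (andE (leE e e′) (leE e′ e)) (λ q → let r , s = and⇒ (leE e e′) (leE e′ e) q in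
      p (≤-antisym (le⇒ e e′ r) (le⇒ e′ e s)))

    ex⇒ : ∀ (e : Exp b (suc n)) → True (exE e) σ ρ → Σ ℕ λ x → True e σ (x ∷ ρ)
    ex⇒ e (by p) = _ , by p

    ⇒ex : ∀ (e : Exp b (suc n)) x → True e σ (x ∷ ρ) → True (exE e) σ ρ
    ⇒ex e x (by p) = by (proj₁ (proj₁ isμ (λ x → eval e σ (x ∷ ρ)) x p))

    opaque
      unfolding exsE

      exs⇒ : ∀ k (e : Exp b (k + n)) → True (exsE k e) σ ρ → Σ (Vec ℕ k) λ ρ′ → True e σ (ρ′ Vec.++ ρ)
      exs⇒ zero    e p = [] , p
      exs⇒ (suc k) e p with exs⇒ k (exE e) p
      ... | ρ′ , by q = _ ∷ ρ′ , by q

      ⇒exs : ∀ k (e : Exp b (k + n)) (ρ′ : Vec ℕ k) → True e σ (ρ′ Vec.++ ρ) → True (exsE k e) σ ρ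
      ⇒exs zero    e []       p = p
      ⇒exs (suc k) e (x ∷ ρ′) (by p) = ⇒exs k (exE e) ρ′ (by (proj₁ (proj₁ isμ (λ x → eval e σ (x ∷ ρ′ Vec.++ ρ)) x p)))

  module _ {k n : ℕ} {f : Ty 1} {ρ : Vec ℕ k} {N : ℕ} {ρ′ : Vec ℕ n} where

    private
      ρ″ : Vec ℕ (k + suc n)
      ρ″ = ρ Vec.++ N ∷ ρ′

    eval-emb : ∀ t → eval (emb t) f ρ″ ≡ tm t ρ
    eval-emb (var i)  = lookup-++ˡ ρ (N ∷ ρ′) i
    eval-emb (lit k)  = refl
    eval-emb (sc t)   = cong suc (eval-emb t)
    eval-emb (pr t u) = cong₂ pair (eval-emb t) (eval-emb u)

    private
      bound : Exp true (k + suc n)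
      bound = var (k ↑ʳ zero)

      eval-bound : eval bound f ρ″ ≡ N
      eval-bound = lookup-++ʳ ρ (N ∷ ρ′) zero

    atom⇒ : ∀ t e → True (atomE t e) f ρ″ → tm t ρ < N × True e f ρ″
    atom⇒ t e p with and⇒ (leE (sc (emb t)) bound) e p
    ... | q , r = subst₂ (λ a b → suc a ≤ b) (eval-emb t) eval-bound (le⇒ (sc (emb t)) bound q) , r

    ⇒atom : ∀ t e → tm t ρ < N → True e f ρ″ → True (atomE t e) f ρ″
    ⇒atom t e p q = ⇒and (leE (sc (emb t)) bound) e
      (⇒le (sc (emb t)) bound (subst₂ (λ a b → suc a ≤ b) (sym (eval-emb t)) (sym eval-bound) p) , q)

    ins⇒ : ∀ ts e → True (insE ts e) f ρ″ → All (λ t → tm t ρ < N × tm t ρ ∈ᶠ f) ts × True e f ρ″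
    ins⇒ []       e p = [] , p
    ins⇒ (t ∷ ts) e p with and⇒ (atomE t (qry (emb t))) (insE ts e) p
    ... | q , r with atom⇒ t (qry (emb t)) q | ins⇒ ts e r
    ... | t<N , by t∈f | rest , s = ((t<N , subst (_∈ᶠ f) (eval-emb t) t∈f) ∷ rest) , s

    ⇒ins : ∀ ts e → All (λ t → tm t ρ < N × tm t ρ ∈ᶠ f) ts → True e f ρ″ → True (insE ts e) f ρ″
    ⇒ins []       e []             q = q
    ⇒ins (t ∷ ts) e ((p , r) ∷ ps) q = ⇒and (atomE t (qry (emb t))) (insE ts e)
      (⇒atom t (qry (emb t)) p (by (subst (_∈ᶠ f) (sym (eval-emb t)) r)) , ⇒ins ts e ps q)

    nes⇒ : ∀ ts e → True (nesE ts e) f ρ″ → All (λ p → tm (proj₁ p) ρ ≢ tm (proj₂ p) ρ) ts × True e f ρ″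
    nes⇒ []             e p = [] , p
    nes⇒ ((t , u) ∷ ts) e p with and⇒ (neE (emb t) (emb u)) (nesE ts e) p
    ... | q , r with nes⇒ ts e r
    ... | qs , s = (subst₂ _≢_ (eval-emb t) (eval-emb u) (ne⇒ (emb t) (emb u) q) ∷ qs) , s

    ⇒nes : ∀ ts e → All (λ p → tm (proj₁ p) ρ ≢ tm (proj₂ p) ρ) ts → True e f ρ″ → True (nesE ts e) f ρ″
    ⇒nes []             e []       q = q
    ⇒nes ((t , u) ∷ ts) e (p ∷ ps) q = ⇒and (neE (emb t) (emb u)) (nesE ts e)
      (⇒ne (emb t) (emb u) (subst₂ _≢_ (sym (eval-emb t)) (sym (eval-emb u)) p) , ⇒nes ts e ps q)

  -- All facts mentioned by the violated instance lie below `N`, where `g` agrees with `f`, so the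
  -- same instance is violated in `g`.
  violated⇒ : ∀ {n f N} {ρ′ : Vec ℕ n} r → True (violatedE r) f (N ∷ ρ′) →
              ∀ g → (∀ i → i < N → g i ≡ f i) → ¬ Holds g r
  violated⇒ {f = f} {N} {ρ′} (rule ins nes out) p g g≗f h with exs⇒ 6 (insE ins (nesE nes (outE out))) p
  ... | ρ , q with ins⇒ {ρ = ρ} ins (nesE nes (outE out)) q
  ... | is , r with nes⇒ {ρ = ρ} nes (outE out) r
  ... | ns , o = refute out o (h ρ (All.map (λ { (t<N , t∈f) → trans (g≗f _ t<N) t∈f }) is) ns)
    where
    refute : ∀ out → True (outE out) f (ρ Vec.++ N ∷ ρ′) → ¬ OutIn g out ρ
    refute (just t) o t∈g with atom⇒ {ρ = ρ} t (notE (qry (emb t))) o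
    ... | t<N , t∉f = not⇒ (qry (emb t)) t∉f
      (by (subst (_∈ᶠ f) (sym (eval-emb {f = f} {ρ = ρ} t)) (trans (sym (g≗f _ t<N)) t∈g)))

  bound-all : ∀ {k} (ρ : Vec ℕ k) ts → Σ ℕ λ N → All (λ t → tm t ρ < N) ts
  bound-all ρ []       = 0 , []
  bound-all ρ (t ∷ ts) with bound-all ρ ts
  ... | N , ps = suc (tm t ρ) + N , m≤m+n _ N ∷ All.map (λ p → ≤-trans p (m≤n+m N _)) ps

  -- An instance mentions finitely many facts, so some `N` exceeds them all; a failing instance
  -- would be a violation for this `N`.
  ⇒violated : ∀ {n f} {ρ′ : Vec ℕ n} r → (∀ N → ¬ True (violatedE r) f (N ∷ ρ′)) → Holds f r
  ⇒violated {f = f} {ρ′} (rule ins nes nothing) p ρ is ns with bound-all ρ ins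
  ... | N , bs = p N (⇒exs 6 (insE ins (nesE nes (lit 0))) ρ (⇒ins {ρ = ρ} ins (nesE nes (lit 0)) (All.zip (bs , is))
                   (⇒nes {ρ = ρ} nes (lit 0) ns (by refl))))
  ⇒violated {f = f} {ρ′} (rule ins nes (just t)) p ρ is ns with f (tm t ρ) ≟ 0 | bound-all ρ (t ∷ ins)
  ... | yes q | _ = q
  ... | no q  | N , b ∷ bs = ⊥-elim (p N (⇒exs 6 (insE ins (nesE nes o)) ρ (⇒ins {ρ = ρ} ins (nesE nes o) (All.zip (bs , is))
                   (⇒nes {ρ = ρ} nes o ns (⇒atom {ρ = ρ} t (notE (qry (emb t))) b
                     (⇒not (qry (emb t)) (λ { (by r) → q (subst (_∈ᶠ f) (eval-emb {f = f} {ρ = ρ} t) r) })))))))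
    where
    o : Exp true (6 + _)
    o = outE (just t)

  -- The formula sees only the six variables of the clause and the bound. In the end this makes the
  -- first error independent of `n`.
  violated-weaken : ∀ {m n f N} {ρ : Vec ℕ m} {ρ′ : Vec ℕ n} r →
                    True (violatedE r) f (N ∷ ρ) → True (violatedE r) f (N ∷ ρ′)
  violated-weaken {f = f} {N} {ρ} {ρ′} (rule ins nes out) p with exs⇒ 6 (insE ins (nesE nes (outE out))) p
  ... | σ , q with ins⇒ {ρ = σ} ins (nesE nes (outE out)) q
  ... | is , r with nes⇒ {ρ = σ} nes (outE out) r
  ... | ns , o = ⇒exs 6 (insE ins (nesE nes (outE out))) σ
      (⇒ins {ρ = σ} ins (nesE nes (outE out)) is (⇒nes {ρ = σ} nes (outE out) ns (weaken out o)))
    where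
    weaken : ∀ out → True (outE out) f (σ Vec.++ N ∷ ρ) → True (outE out) f (σ Vec.++ N ∷ ρ′)
    weaken nothing  _ = by refl
    weaken (just t) o with atom⇒ {ρ = σ} t (notE (qry (emb t))) o
    ... | b , c = ⇒atom {ρ = σ} t (notE (qry (emb t))) b (⇒not (qry (emb t)) (λ { (by d) →
            not⇒ (qry (emb t)) c (by (trans (cong f (trans (eval-emb {f = f} {ρ = σ} t) (sym (eval-emb {f = f} {ρ = σ} t)))) d)) }))

  violation⇒ : ∀ {n f N} {ρ : Vec ℕ n} rs → True (violationE rs) f (N ∷ ρ) →
               Any (λ r → True (violatedE r) f (N ∷ ρ)) rs
  violation⇒ (r ∷ rs) p with or⇒ (violatedE r) (violationE rs) p
  ... | inj₁ q = here q
  ... | inj₂ q = there (violation⇒ rs q)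

  ⇒violation : ∀ {n f N} {ρ : Vec ℕ n} rs → Any (λ r → True (violatedE r) f (N ∷ ρ)) rs →
               True (violationE rs) f (N ∷ ρ)
  ⇒violation (r ∷ rs) (here p)  = ⇒or (violatedE r) (violationE rs) (inj₁ p)
  ⇒violation (r ∷ rs) (there p) = ⇒or (violatedE r) (violationE rs) (inj₂ (⇒violation rs p))

  violation-refutes : ∀ {n f N} {ρ : Vec ℕ n} rs → True (violationE rs) f (N ∷ ρ) →
                      ∀ g → (∀ i → i < N → g i ≡ f i) → ¬ All (Holds g) rs
  violation-refutes rs p g g≗f = refute (violation⇒ rs p)
    where
    refute : ∀ {rs} → Any (λ r → True (violatedE r) _ _) rs → ¬ All (Holds g) rs
    refute (here {r} v) (h ∷ hs) = violated⇒ r v g g≗f h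
    refute (there vs)   (h ∷ hs) = refute vs hs

  no-violation : ∀ {n f} {ρ : Vec ℕ n} rs → (∀ N → ¬ True (violationE rs) f (N ∷ ρ)) → All (Holds f) rs
  no-violation {f = f} {ρ} rs p = holds rs (λ N v → p N (⇒violation rs v))
    where
    holds : ∀ rs → (∀ N → ¬ Any (λ r → True (violatedE r) f (N ∷ ρ)) rs) → All (Holds f) rs
    holds []       q = []
    holds (r ∷ rs) q = ⇒violated r (λ N v → q N (here v)) ∷ holds rs (λ N v → q N (there v))

  violation-weaken : ∀ {m n f N} {ρ : Vec ℕ m} {ρ′ : Vec ℕ n} rs →
                     True (violationE rs) f (N ∷ ρ) → True (violationE rs) f (N ∷ ρ′)
  violation-weaken rs p = ⇒violation rs (Any.map (λ {r} → violated-weaken r) (violation⇒ rs p))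

-- Elementary properties of `μ`

module _ {μ : Ty 2} (isμ : IsMu μ) where

  μ-zero : ∀ f n → f n ≡ 0 → f (μ f) ≡ 0
  μ-zero f n p = proj₁ (proj₁ isμ f n p)

  μ-min : ∀ f n → f n ≡ 0 → μ f ≤ n
  μ-min f n p = proj₂ (proj₁ isμ f n p)

  μ-cong : ∀ {g h} → (∀ n → g n ≡ 0 → h n ≡ 0) → (∀ n → h n ≡ 0 → g n ≡ 0) → μ g ≡ μ h
  μ-cong {g} {h} g⇒h h⇒g with h (μ h) ≟ 0
  ... | yes p = ≤-antisym (μ-min g _ (h⇒g _ p)) (μ-min h _ (g⇒h _ (μ-zero g _ (h⇒g _ p))))
  -- Neither function has a zero, and both searches return the default value 0.
  ... | no ¬p = trans (proj₂ isμ g λ n z → ¬p (μ-zero h n (g⇒h n z)))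
                  (sym (proj₂ isμ h λ n z → ¬p (μ-zero h n z)))

  μ-ext : ∀ {g h} → g ≗ h → μ g ≡ μ h
  μ-ext e = μ-cong (λ n → trans (sym (e n))) (λ n → trans (e n))

  μ-least : ∀ f n → f n ≡ 0 → (∀ m → m < n → f m ≢ 0) → μ f ≡ n
  μ-least f n p q with m≤n⇒m<n∨m≡n (μ-min f n p)
  ... | inj₁ l = ⊥-elim (q _ l (μ-zero f n p))
  ... | inj₂ e = e

-- Bad nodes and the modulus

callAtom : ℕ → ℕ → ℕ → ℕ → ℕ
callAtom s o c as = pair (pair 0 s) (pair (pair 7 c) (cons o as))

valueAtom : ℕ → ℕ → ℕ
valueAtom s v = pair (pair 1 s) v

belowAtom : ℕ → ℕ → ℕ
belowAtom t s = pair (pair 5 (pair t s)) 1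

module Errors (μ : Ty 2) (isμ : IsMu μ) (F : Ty 2) (choose : ℕ → Ty 1 → Ty 1) where
  open Semantics μ F choose
  open Truth μ isμ F choose

  -- The least value that `f` claims for child `x` of `s`, or 0 if it claims none.
  childValue : (ℕ → ℕ) → ℕ → ℕ → ℕ
  childValue f s x = μ (λ y → f (valueAtom (cons x s) y))

  answer : (ℕ → ℕ) → ℕ → ℕ → ℕ
  answer f s o = recℕ o (F (choose s (childValue f s))) (λ _ _ → μ (childValue f s))

  Bad : (ℕ → ℕ) → ℕ → ℕ → ℕ → ℕ → Set
  Bad f s o c as = callAtom s o c as ∈ᶠ f × ¬ (valueAtom s (answer f s o) ∈ᶠ f)

  NoBad : (ℕ → ℕ) → ℕ → Set
  NoBad f s = ∀ o c as → ¬ Bad f s o c as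

  MinBad : (ℕ → ℕ) → ℕ → ℕ → ℕ → ℕ → Set
  MinBad f s o c as = Bad f s o c as × (∀ t → belowAtom t s ∈ᶠ f → NoBad f t)

  bad⇒ : ∀ {n f s o c as} {ρ : Vec ℕ n} → True badE f (as ∷ c ∷ o ∷ s ∷ ρ) → Bad f s o c as
  bad⇒ p with and⇒ (qry callE) (notE (qry answerE)) p
  ... | by q , r = q , λ t → not⇒ (qry answerE) r (by t)

  ⇒bad : ∀ {n f s o c as} {ρ : Vec ℕ n} → Bad f s o c as → True badE f (as ∷ c ∷ o ∷ s ∷ ρ)
  ⇒bad (p , q) = ⇒and (qry callE) (notE (qry answerE)) (by p , ⇒not (qry answerE) (λ { (by r) → q r }))

  private
    belowE : ∀ {n} → Exp true (5 + n)
    belowE = qry (pr (pr (lit 5) (pr (var (# 0)) (var (# 4)))) (lit 1))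

    boundsE : ∀ {n} → Exp true (5 + n)
    boundsE = andE (leE (sc callE) (var (# 4))) (leE (sc answerE) (var (# 4)))

  minBad⇒ : ∀ {n f N} {ρ : Vec ℕ n} → True minBadE f (N ∷ ρ) →
    Σ ℕ λ s → Σ ℕ λ o → Σ ℕ λ c → Σ ℕ λ as →
      MinBad f s o c as × callAtom s o c as < N × valueAtom s (answer f s o) < N
  minBad⇒ {f = f} {N} {ρ} p with exs⇒ 4 _ p
  ... | as ∷ c ∷ o ∷ s ∷ [] , q with and⇒ (andE badE (notE badBelowE)) boundsE q
  ... | r , b with and⇒ badE (notE badBelowE) r | and⇒ (leE (sc callE) (var (# 4))) (leE (sc answerE) (var (# 4))) b
  ... | bad , minimal | l , m =
    s , o , c , as , (bad⇒ bad , least) , le⇒ (sc callE) (var (# 4)) l , le⇒ (sc answerE) (var (# 4)) m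
    where
    least : ∀ t → belowAtom t s ∈ᶠ f → NoBad f t
    least t t<s o′ c′ as′ bad′ = not⇒ badBelowE minimal (⇒ex (andE belowE (exsE 3 badE)) t
      (⇒and belowE (exsE 3 badE) (by t<s , ⇒exs 3 badE (as′ ∷ c′ ∷ o′ ∷ []) (⇒bad bad′))))

  ⇒minBad : ∀ {n f s o c as N} {ρ : Vec ℕ n} → MinBad f s o c as →
            callAtom s o c as < N → valueAtom s (answer f s o) < N → True minBadE f (N ∷ ρ)
  ⇒minBad {f = f} {s} {o} {c} {as} {N} {ρ} (bad , least) l m = ⇒exs 4 _ (as ∷ c ∷ o ∷ s ∷ [])
    (⇒and (andE badE (notE badBelowE)) boundsE
      ( ⇒and badE (notE badBelowE) (⇒bad bad , ⇒not badBelowE noneBelow)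
      , ⇒and (leE (sc callE) (var (# 4))) (leE (sc answerE) (var (# 4)))
          (⇒le (sc callE) (var (# 4)) l , ⇒le (sc answerE) (var (# 4)) m)))
    where
    noneBelow : ¬ True badBelowE f (as ∷ c ∷ o ∷ s ∷ N ∷ ρ)
    noneBelow p with ex⇒ (andE belowE (exsE 3 badE)) p
    ... | t , q with and⇒ belowE (exsE 3 badE) q
    ... | by t<s , r with exs⇒ 3 badE r
    ... | as′ ∷ c′ ∷ o′ ∷ [] , bad′ = least t t<s o′ c′ as′ (bad⇒ bad′)

  module _ (rs : List Rule) where

    Right : (ℕ → ℕ) → Set
    Right f = All (Holds f) rs × (∀ s o c as → ¬ MinBad f s o c as)

    private
      clean : ∀ {n} → Exp true n
      clean = notE (exE (violationE rs))

    opaque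
      unfolding errorE

      error⇒ : ∀ {n f N} {ρ : Vec ℕ n} → True (errorE rs) f (N ∷ ρ) →
        (∀ g → (∀ i → i < N → g i ≡ f i) → ¬ All (Holds g) rs) ⊎
        (All (Holds f) rs × Σ ℕ λ s → Σ ℕ λ o → Σ ℕ λ c → Σ ℕ λ as →
          MinBad f s o c as × callAtom s o c as < N × valueAtom s (answer f s o) < N)
      error⇒ p with or⇒ (violationE rs) (andE clean minBadE) p
      ... | inj₁ q = inj₁ (violation-refutes rs q)
      ... | inj₂ q with and⇒ clean minBadE q
      ... | r , m = inj₂ (no-violation rs (λ N v → not⇒ (exE (violationE rs)) r (⇒ex (violationE rs) N v)) , minBad⇒ m)

      no-error : ∀ {n f} {ρ : Vec ℕ n} → (∀ N → ¬ True (errorE rs) f (N ∷ ρ)) → Right f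
      no-error {f = f} {ρ} p = no-violation {ρ = ρ} rs none , λ s o c as m →
          -- A bound that exceeds both facts of the minimal bad node.
          p (suc (callAtom s o c as) + suc (valueAtom s (answer f s o)))
            (⇒or (violationE rs) (andE clean minBadE) (inj₂ (⇒and clean minBadE
              ( ⇒not (exE (violationE rs)) (λ e → let N , v = ex⇒ (violationE rs) e in none N (violation-weaken rs v))
              , ⇒minBad m (m≤m+n _ _) (m≤n+m _ (suc (callAtom s o c as)))))))
        where
        none : ∀ N → ¬ True (violationE rs) f (N ∷ ρ)
        none N v = p N (⇒or (violationE rs) (andE clean minBadE) (inj₁ v))

      error-weaken : ∀ {m n f N} {ρ : Vec ℕ m} {ρ′ : Vec ℕ n} →
                     True (errorE rs) f (N ∷ ρ) → True (errorE rs) f (N ∷ ρ′)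
      error-weaken p with or⇒ (violationE rs) (andE clean minBadE) p
      ... | inj₁ q = ⇒or (violationE rs) (andE clean minBadE) (inj₁ (violation-weaken rs q))
      ... | inj₂ q with and⇒ clean minBadE q
      ... | r , m with minBad⇒ m
      ... | s , o , c , as , mb , k , l = ⇒or (violationE rs) (andE clean minBadE) (inj₂ (⇒and clean minBadE
              ( ⇒not (exE (violationE rs)) (λ e → let N , v = ex⇒ (violationE rs) e in
                  not⇒ (exE (violationE rs)) r (⇒ex (violationE rs) N (violation-weaken rs v)))
              , ⇒minBad mb k l)))

    modulus : ℕ → ℕ → (ℕ → ℕ) → ℕ
    modulus w n f = eval (modulusE rs) f (n ∷ w ∷ [])

    firstError : ℕ → ℕ → (ℕ → ℕ) → ℕ
    firstError w n f = eval (mu (errorE rs)) f (n ∷ w ∷ [])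

    final : ℕ → ℕ → (ℕ → ℕ) → ℕ
    final w n f = recℕ (f (valueAtom 0 w)) n (λ _ _ → 0)

    -- If any bound satisfies the error formula then so does the one found by `μ`; failure there
    -- excludes all bounds.
    modulus-cases : ∀ w n f →
      (True (errorE rs) f (firstError w n f ∷ n ∷ w ∷ []) × modulus w n f ≡ firstError w n f) ⊎
      ((∀ N → ¬ True (errorE rs) f (N ∷ n ∷ w ∷ [])) × modulus w n f ≡ final w n f)
    modulus-cases w n f = go _ refl
      where
      N : ℕ
      N = firstError w n f
      go : ∀ e → eval (errorE rs) f (N ∷ n ∷ w ∷ []) ≡ e →
           (True (errorE rs) f (N ∷ n ∷ w ∷ []) × modulus w n f ≡ N) ⊎
           ((∀ N → ¬ True (errorE rs) f (N ∷ n ∷ w ∷ [])) × modulus w n f ≡ final w n f)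
      go zero    p = inj₁ (by p , cong (λ e → recℕ e N (λ _ _ → final w n f)) p)
      go (suc e) p = inj₂ ((λ K q → 0≢1+n (trans (sym (isTrue (⇒ex (errorE rs) K q))) p)) ,
                           cong (λ e → recℕ e N (λ _ _ → final w n f)) p)

    -- If there is an error, its least bound is the same for `m` and `n`, since the error formula
    -- ignores both. Otherwise `f` is right, so it does not give `w` to the root and the modulus is
    -- 0.
    modulus-const : ∀ w m n f → (Right f → ¬ valueAtom 0 w ∈ᶠ f) → modulus w m f ≡ modulus w n f
    modulus-const w m n f out with modulus-cases w m f | modulus-cases w n f
    ... | inj₁ (_ , p) | inj₁ (_ , q) = trans p (trans (μ-cong isμ (λ N z → isTrue (error-weaken (by z)))
                                                            (λ N z → isTrue (error-weaken (by z)))) (sym q))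
    ... | inj₁ (e , _) | inj₂ (none , _) = ⊥-elim (none _ (error-weaken e))
    ... | inj₂ (none , _) | inj₁ (e , _) = ⊥-elim (none _ (error-weaken e))
    ... | inj₂ (none , p) | inj₂ (_ , q) = trans p (trans (final-const (f (valueAtom 0 w)) refl) (sym q))
      where
      final-const : ∀ a → f (valueAtom 0 w) ≡ a → recℕ a m (λ _ _ → 0) ≡ recℕ a n (λ _ _ → 0)
      final-const zero    z = ⊥-elim (out (no-error none) z)
      final-const (suc a) _ = refl

-- Computations as trees of coded tuples

data Shape : Set where
  leaf : ℕ → Shape
  tail : ℕ → Shape
  bind : ℕ → ℕ → ℕ → Shape
  orac : ℕ → ℕ → ℕ → Shape

codeShape : Shape → ℕ
codeShape (leaf v)      = pair 0 v
codeShape (tail y)      = pair 1 y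
codeShape (bind y c as) = pair 2 (pair y (pair c as))
codeShape (orac o c as) = pair 3 (pair o (pair c as))

pickList : ℕ → List ℕ → Maybe (List ℕ)
pickMore : ℕ → Maybe (List ℕ) → Maybe (List ℕ)
pickList _       []       = nothing
pickList zero    (a ∷ as) = just (a ∷ as)
pickList (suc i) (a ∷ as) = pickMore a (pickList i as)
pickMore a (just (b ∷ bs)) = just (b ∷ a ∷ bs)
pickMore a _               = nothing

-- The tuple pair (pair op arg) as stands for an index and its arguments, where pair op arg is the code of the
-- index, and in the list coded by as 0 stands for F, 1 for μ and 2 + x for the number x.
opShape : ℕ → ℕ → List ℕ → Maybe Shape
opShape 0 _  (suc (suc x) ∷ _)        = just (leaf (suc x))
opShape 1 q  _                        = just (leaf q)
opShape 2 _  (suc (suc x) ∷ _)        = just (leaf x)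
opShape 3 cd as                       = just (bind (pair (proj₂ (unpair cd)) (enc as)) (proj₁ (unpair cd)) (enc as))
opShape 4 cd (2 ∷ as)                 = just (tail (pair (proj₁ (unpair cd)) (enc as)))
opShape 4 cd (suc (suc (suc x)) ∷ as) = just (bind (pair (pair 4 cd) (cons (2 + x) (enc as))) (proj₂ (unpair cd)) (cons (2 + x) (enc as)))
opShape 5 ic as                       = Maybe.map (λ l → tail (pair (proj₂ (unpair ic)) (enc l))) (pickList (proj₁ (unpair ic)) as)
opShape 7 c  (o ∷ as)                 = just (orac o c (enc as))
opShape 8 m  (suc (suc c) ∷ as)       = just (tail (pair c (enc (List.take m as))))
opShape _ _  _                        = nothing

shape : ℕ → Maybe Shape
shape x = opShape (proj₁ (unpair (proj₁ (unpair x)))) (proj₂ (unpair (proj₁ (unpair x)))) (dec (proj₂ (unpair x)))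

shape-tuple : ∀ op arg as → shape (pair (pair op arg) as) ≡ opShape op arg (dec as)
shape-tuple op arg as rewrite unpair-pair (pair op arg) as | unpair-pair op arg = refl

pair-0-0 : pair 0 0 ≡ 0
pair-0-0 = pair≡⟪⟫ 0 0

shape-0 : shape 0 ≡ nothing
shape-0 = subst (λ x → shape x ≡ nothing) (trans (cong (λ x → pair x 0) pair-0-0) pair-0-0)
            (trans (shape-tuple 0 0 0) (cong (opShape 0 0) (dec-enc [])))

shape-call : ∀ c o as → shape (pair (pair 7 c) (cons o as)) ≡ just (orac o c as)
shape-call c o as = trans (shape-tuple 7 c (cons o as))
  (trans (cong (opShape 7 c) (dec-cons o as)) (cong (λ l → just (orac o c l)) (enc-dec as)))

data StrictlyBelow (s : ℕ) : ℕ → Set where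
  one  : ∀ {i} → StrictlyBelow s (cons i s)
  more : ∀ {i t} → StrictlyBelow s t → StrictlyBelow s (cons i t)

AtOrBelow : ℕ → ℕ → Set
AtOrBelow s t = t ≡ s ⊎ StrictlyBelow s t

below-child : ∀ {s t} → StrictlyBelow s t → Σ ℕ λ i → AtOrBelow (cons i s) t
below-child (one {i}) = i , inj₁ refl
below-child (more p) with below-child p
... | i , inj₁ refl = i , inj₂ one
... | i , inj₂ q    = i , inj₂ (more q)

child-below : ∀ {i s t} → AtOrBelow (cons i s) t → StrictlyBelow s t
child-below (inj₁ refl)     = one
child-below (inj₂ one)      = more one
child-below (inj₂ (more p)) = more (child-below (inj₂ p))

code : Code → ℕ
code s1       = pair 0 0
code (s2 q)   = pair 1 q
code s3       = pair 2 0
code (s4 c d) = pair 3 (pair (code c) (code d))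
code (s5 c d) = pair 4 (pair (code c) (code d))
code (s6 i c) = pair 5 (pair i (code c))
code s7       = pair 6 0
code (s8 c)   = pair 7 (code c)
code (s9 m)   = pair 8 m

-- S9 receives its index as the number `encode c`, so the tuples have to follow the same numbering.
code≡encode : ∀ c → code c ≡ encode c
code≡encode s1       = pair≡⟪⟫ 0 0
code≡encode (s2 q)   = pair≡⟪⟫ 1 q
code≡encode s3       = pair≡⟪⟫ 2 0
code≡encode (s4 c d) rewrite code≡encode c | code≡encode d | pair≡⟪⟫ (encode c) (encode d) = pair≡⟪⟫ 3 _
code≡encode (s5 c d) rewrite code≡encode c | code≡encode d | pair≡⟪⟫ (encode c) (encode d) = pair≡⟪⟫ 4 _
code≡encode (s6 i c) rewrite code≡encode c | pair≡⟪⟫ i (encode c) = pair≡⟪⟫ 5 _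
code≡encode s7       = pair≡⟪⟫ 6 0
code≡encode (s8 c)   rewrite code≡encode c = pair≡⟪⟫ 7 _
code≡encode (s9 m)   = pair≡⟪⟫ 8 m

tuple : Code → List ℕ → ℕ
tuple c as = pair (code c) (enc as)

module Derivations (μ : Ty 2) (F : Ty 2) where

  oracle : ℕ → (ℕ → ℕ) → ℕ
  oracle zero    = F
  oracle (suc _) = μ

  -- Computation trees over coded tuples. Only S8 keeps its own constructor, which records the
  -- function `g` given to the oracle.
  data Run : ℕ → ℕ → Set where
    leafR : ∀ {x v} → shape x ≡ just (leaf v) → Run x v
    tailR : ∀ {x y v} → shape x ≡ just (tail y) → Run y v → Run x v
    bindR : ∀ {x y c as w v} → shape x ≡ just (bind y c as) → Run y w → Run (pair c (cons (2 + w) as)) v → Run x v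
    oracR : ∀ {o c as} (g : ℕ → ℕ) → (∀ n → Run (pair c (cons o (cons (2 + n) as))) (g n)) →
            Run (pair (pair 7 c) (cons o as)) (oracle o g)

  symbol : ℕ → Arg
  symbol 0             = 2 , F
  symbol 1             = 2 , μ
  symbol (suc (suc x)) = 0 , x

  symbols : List ℕ → Args
  symbols = List.map symbol

  shape-op : ∀ op arg as → shape (pair (pair op arg) (enc as)) ≡ opShape op arg as
  shape-op op arg as = trans (shape-tuple op arg (enc as)) (cong (opShape op arg) (dec-enc as))

  pick-symbols : ∀ i as {a rest} → pick i (symbols as) ≡ just (a , rest) →
                 Σ ℕ λ b → Σ (List ℕ) λ bs → pickList i as ≡ just (b ∷ bs) × symbol b ≡ a × symbols bs ≡ rest
  pick-symbols zero    (b ∷ bs) refl = b , bs , refl , refl , refl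
  pick-symbols (suc i) (x ∷ as) p with pick i (symbols as) in eq
  pick-symbols (suc i) (x ∷ as) refl | just (a , rest) with pick-symbols i as eq
  ... | b , bs , q , refl , refl = b , x ∷ bs , cong (pickMore x) q , refl , refl

  take-symbols : ∀ m as → List.take m (symbols as) ≡ symbols (List.take m as)
  take-symbols zero    as       = refl
  take-symbols (suc m) []       = refl
  take-symbols (suc m) (a ∷ as) = cong (symbol a ∷_) (take-symbols m as)

  -- Starting from `F` and `μ`, all arguments remain `F`, `μ` or numbers, because S4, S5 and S8 at
  -- type 2 add only numbers. So symbol lists suffice and S7 never applies.
  toRun : ∀ {c args v} → Comp c args v → ∀ as → symbols as ≡ args → Run (tuple c as) v
  toRun S1 (suc (suc x) ∷ as) refl = leafR (shape-op 0 0 (2 + x ∷ as))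
  toRun S2 as refl = leafR (shape-op 1 _ as)
  toRun S3 (suc (suc x) ∷ as) refl = leafR (shape-op 2 0 (2 + x ∷ as))
  toRun (S4 {c} {d} {w = w} p q) as refl = bindR sh (toRun p as refl) (toRun q (2 + w ∷ as) refl)
    where
    sh : shape (tuple (s4 c d) as) ≡ just (bind (tuple d as) (code c) (enc as))
    sh = trans (shape-op 3 _ as) (cong (λ p → just (bind (pair (proj₂ p) (enc as)) (proj₁ p) (enc as))) (unpair-pair (code c) (code d)))
  toRun (S5-0 {c} {d} p) (2 ∷ as) refl = tailR sh (toRun p as refl)
    where
    sh : shape (tuple (s5 c d) (2 ∷ as)) ≡ just (tail (tuple c as))
    sh = trans (shape-op 4 _ (2 ∷ as)) (cong (λ p → just (tail (pair (proj₁ p) (enc as)))) (unpair-pair (code c) (code d)))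
  toRun (S5-s {c} {d} {x} {w = w} p q) (suc (suc (suc x)) ∷ as) refl =
    bindR sh (toRun p (2 + x ∷ as) refl) (toRun q (2 + w ∷ 2 + x ∷ as) refl)
    where
    sh : shape (tuple (s5 c d) (3 + x ∷ as)) ≡ just (bind (tuple (s5 c d) (2 + x ∷ as)) (code d) (enc (2 + x ∷ as)))
    sh = trans (shape-op 4 _ (3 + x ∷ as))
           (cong (λ p → just (bind (tuple (s5 c d) (2 + x ∷ as)) (proj₂ p) (enc (2 + x ∷ as)))) (unpair-pair (code c) (code d)))
  toRun (S6 {i} {c} p q) as refl with pick-symbols i as p
  ... | b , bs , r , refl , refl = tailR sh (toRun q (b ∷ bs) refl)
    where
    sh : shape (tuple (s6 i c) as) ≡ just (tail (tuple c (b ∷ bs)))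
    sh = trans (shape-op 5 _ as) (trans
      (cong (λ p → Maybe.map (λ l → tail (pair (proj₂ p) (enc l))) (pickList (proj₁ p) as)) (unpair-pair i (code c)))
      (cong (Maybe.map (λ l → tail (tuple c l))) r))
  toRun (S8 g p) (0 ∷ as) refl = oracR g (λ n → toRun (p n) (0 ∷ 2 + n ∷ as) refl)
  toRun (S8 g p) (1 ∷ as) refl = oracR g (λ n → toRun (p n) (1 ∷ 2 + n ∷ as) refl)
  toRun (S9 {m} {c} p) (suc (suc x) ∷ as) refl = tailR sh (toRun p (List.take m as) (sym (take-symbols m as)))
    where
    sh : shape (tuple (s9 m) (2 + encode c ∷ as)) ≡ just (tail (tuple c (List.take m as)))
    sh = trans (shape-op 8 m (2 + encode c ∷ as)) (cong (λ k → just (tail (pair k (enc (List.take m as))))) (sym (code≡encode c)))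

-- Consequences of the clauses

nth : ∀ {A : Set} {P : A → Set} {xs} → All P xs → (i : Fin (List.length xs)) → P (List.lookup xs i)
nth (p ∷ ps) zero    = p
nth (p ∷ ps) (suc i) = nth ps i

NonCall : Shape → Set
NonCall (orac _ _ _) = ⊥
NonCall _            = ⊤

atom : ℕ → ℕ → ℕ → ℕ
atom k x y = pair (pair k x) y

-- Clauses are cited by their place in `rules`; zeros pad the assignments to six variables.
module Laws {f : ℕ → ℕ} {root : ℕ} (hs : All (Holds f) (rules root)) where

  unique : ∀ r {y y′} → pair r y ∈ᶠ f → pair r y′ ∈ᶠ f → y ≡ y′
  unique r {y} {y′} p q with y ≟ y′
  ... | yes e = e
  ... | no ne = ⊥-elim (nth hs (# 0) (r ∷ y ∷ y′ ∷ 0 ∷ 0 ∷ 0 ∷ []) (p ∷ q ∷ []) (ne ∷ []))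

  root-node : atom 0 0 root ∈ᶠ f
  root-node = nth hs (# 1) (0 ∷ 0 ∷ 0 ∷ 0 ∷ 0 ∷ 0 ∷ []) [] []

  pick-complete : ∀ i as {l} → pickList i as ≡ just l → atom 3 (pair i (enc as)) (enc l) ∈ᶠ f
  pick-complete zero    (a ∷ as) refl = nth hs (# 10) (a ∷ enc as ∷ 0 ∷ 0 ∷ 0 ∷ 0 ∷ []) [] []
  pick-complete (suc i) (a ∷ as) p with pickList i as in eq
  pick-complete (suc i) (a ∷ as) refl | just (b ∷ bs) =
    nth hs (# 11) (i ∷ enc as ∷ b ∷ enc bs ∷ a ∷ 0 ∷ []) (pick-complete i as eq ∷ []) []

  take-complete : ∀ m as → atom 4 (pair m (enc as)) (enc (List.take m as)) ∈ᶠ f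
  take-complete zero    as       = nth hs (# 12) (enc as ∷ 0 ∷ 0 ∷ 0 ∷ 0 ∷ 0 ∷ []) [] []
  take-complete (suc m) []       = nth hs (# 13) (suc m ∷ 0 ∷ 0 ∷ 0 ∷ 0 ∷ 0 ∷ []) [] []
  take-complete (suc m) (a ∷ as) =
    nth hs (# 14) (m ∷ enc as ∷ enc (List.take m as) ∷ a ∷ 0 ∷ 0 ∷ []) (take-complete m as ∷ []) []

  op-complete : ∀ op arg as {σ} → opShape op arg as ≡ just σ → NonCall σ →
                atom 2 (pair (pair op arg) (enc as)) (codeShape σ) ∈ᶠ f
  op-complete 0 arg (suc (suc x) ∷ as) refl _ = nth hs (# 2) (x ∷ enc as ∷ arg ∷ 0 ∷ 0 ∷ 0 ∷ []) [] []
  op-complete 1 q as refl _ = nth hs (# 3) (q ∷ enc as ∷ 0 ∷ 0 ∷ 0 ∷ 0 ∷ []) [] []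
  op-complete 2 arg (suc (suc x) ∷ as) refl _ = nth hs (# 4) (x ∷ enc as ∷ arg ∷ 0 ∷ 0 ∷ 0 ∷ []) [] []
  op-complete 3 cd as {σ} refl _ =
    -- The clause speaks of a pair of indices, and every number `cd` is such a pair.
    subst (λ k → atom 2 (pair (pair 3 k) (enc as)) (codeShape σ) ∈ᶠ f) (pair-unpair cd)
      (nth hs (# 5) (proj₁ (unpair cd) ∷ proj₂ (unpair cd) ∷ enc as ∷ 0 ∷ 0 ∷ 0 ∷ []) [] [])
  op-complete 4 cd (2 ∷ as) {σ} refl _ =
    subst (λ k → atom 2 (pair (pair 4 k) (cons 2 (enc as))) (codeShape σ) ∈ᶠ f) (pair-unpair cd)
      (nth hs (# 6) (proj₁ (unpair cd) ∷ proj₂ (unpair cd) ∷ enc as ∷ 0 ∷ 0 ∷ 0 ∷ []) [] [])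
  op-complete 4 cd (suc (suc (suc x)) ∷ as) refl _ =
    subst (λ k → atom 2 (pair (pair 4 k) (cons (3 + x) (enc as)))
                   (codeShape (bind (pair (pair 4 k) (cons (2 + x) (enc as))) (proj₂ (unpair cd)) (cons (2 + x) (enc as)))) ∈ᶠ f)
      (pair-unpair cd)
      (nth hs (# 7) (proj₁ (unpair cd) ∷ proj₂ (unpair cd) ∷ x ∷ enc as ∷ 0 ∷ 0 ∷ []) [] [])
  op-complete 5 ic as p _ with pickList (proj₁ (unpair ic)) as in eq
  op-complete 5 ic as refl _ | just l =
    subst (λ k → atom 2 (pair (pair 5 k) (enc as)) (codeShape (tail (pair (proj₂ (unpair ic)) (enc l)))) ∈ᶠ f) (pair-unpair ic)
      (nth hs (# 8) (proj₁ (unpair ic) ∷ enc as ∷ enc l ∷ proj₂ (unpair ic) ∷ 0 ∷ 0 ∷ [])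
        (pick-complete (proj₁ (unpair ic)) as eq ∷ []) [])
  op-complete 7 c (o ∷ as) refl ()
  op-complete 8 m (suc (suc c) ∷ as) refl _ =
    nth hs (# 9) (m ∷ enc as ∷ enc (List.take m as) ∷ c ∷ 0 ∷ 0 ∷ []) (take-complete m as ∷ []) []

  shape-complete : ∀ x {σ} → shape x ≡ just σ → NonCall σ → atom 2 x (codeShape σ) ∈ᶠ f
  shape-complete x {σ} p nc = subst (λ k → atom 2 k (codeShape σ) ∈ᶠ f)
    (trans (cong₂ pair (pair-unpair (proj₁ (unpair x))) (enc-dec (proj₂ (unpair x)))) (pair-unpair x))
    (op-complete _ _ _ p nc)

  -- Recursion along the path shows that the clauses force some value, which is 1 only for true
  -- descendants. With `unique` this refutes every false claim of being below.
  below-total : ∀ l s → Σ ℕ λ b → atom 5 (pair (enc l) s) b ∈ᶠ f × (b ≡ 1 → StrictlyBelow s (enc l))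
  below-total []      s = 0 , nth hs (# 26) (s ∷ 0 ∷ 0 ∷ 0 ∷ 0 ∷ 0 ∷ []) [] [] , λ ()
  below-total (i ∷ l) s with enc l ≟ s | below-total l s
  ... | yes refl | _         = 1 , nth hs (# 27) (i ∷ enc l ∷ 0 ∷ 0 ∷ 0 ∷ 0 ∷ []) [] [] , λ _ → one
  ... | no ne    | b , p , q = b , nth hs (# 28) (enc l ∷ s ∷ b ∷ i ∷ 0 ∷ 0 ∷ []) (p ∷ []) (ne ∷ []) , λ e → more (q e)

  below-sound : ∀ {t s} → belowAtom t s ∈ᶠ f → StrictlyBelow s t
  below-sound {t} {s} p with below-total (dec t) s
  ... | b , q , r rewrite enc-dec t = r (unique _ q p)

  below-complete : ∀ {t s} → StrictlyBelow s t → belowAtom t s ∈ᶠ f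
  below-complete {s = s} (one {i}) = nth hs (# 27) (i ∷ s ∷ 0 ∷ 0 ∷ 0 ∷ 0 ∷ []) [] []
  below-complete {s = s} (more {i} {t} p) with t ≟ s
  ... | yes refl = nth hs (# 27) (i ∷ t ∷ 0 ∷ 0 ∷ 0 ∷ 0 ∷ []) [] []
  ... | no ne    = nth hs (# 28) (t ∷ s ∷ 1 ∷ i ∷ 0 ∷ 0 ∷ []) (below-complete p ∷ []) (ne ∷ [])

  module _ {s x : ℕ} (node : atom 0 s x ∈ᶠ f) where

    leaf-value : ∀ {v} → shape x ≡ just (leaf v) → valueAtom s v ∈ᶠ f
    leaf-value {v} p = nth hs (# 15) (s ∷ x ∷ v ∷ 0 ∷ 0 ∷ 0 ∷ []) (node ∷ shape-complete x p tt ∷ []) []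

    leaf-rest : ∀ {v} → shape x ≡ just (leaf v) → ∀ i → atom 0 (cons i s) 0 ∈ᶠ f
    leaf-rest {v} p i = nth hs (# 16) (s ∷ x ∷ v ∷ i ∷ 0 ∷ 0 ∷ []) (node ∷ shape-complete x p tt ∷ []) []

    tail-child : ∀ {y} → shape x ≡ just (tail y) → atom 0 (cons 0 s) y ∈ᶠ f
    tail-child {y} p = nth hs (# 17) (s ∷ x ∷ y ∷ 0 ∷ 0 ∷ 0 ∷ []) (node ∷ shape-complete x p tt ∷ []) []

    tail-value : ∀ {y v} → shape x ≡ just (tail y) → valueAtom (cons 0 s) v ∈ᶠ f → valueAtom s v ∈ᶠ f
    tail-value {y} {v} p q = nth hs (# 18) (s ∷ x ∷ y ∷ v ∷ 0 ∷ 0 ∷ []) (node ∷ shape-complete x p tt ∷ q ∷ []) []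

    tail-rest : ∀ {y} → shape x ≡ just (tail y) → ∀ i → atom 0 (cons (suc i) s) 0 ∈ᶠ f
    tail-rest {y} p i = nth hs (# 19) (s ∷ x ∷ y ∷ i ∷ 0 ∷ 0 ∷ []) (node ∷ shape-complete x p tt ∷ []) []

    module _ {y c as : ℕ} (p : shape x ≡ just (bind y c as)) where

      bind-first : atom 0 (cons 0 s) y ∈ᶠ f
      bind-first = nth hs (# 20) (s ∷ x ∷ y ∷ c ∷ as ∷ 0 ∷ []) (node ∷ shape-complete x p tt ∷ []) []

      bind-second : ∀ {w} → valueAtom (cons 0 s) w ∈ᶠ f → atom 0 (cons 1 s) (pair c (cons (2 + w) as)) ∈ᶠ f
      bind-second {w} q = nth hs (# 21) (s ∷ x ∷ y ∷ c ∷ as ∷ w ∷ []) (node ∷ shape-complete x p tt ∷ q ∷ []) []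

      bind-value : ∀ {v} → valueAtom (cons 1 s) v ∈ᶠ f → valueAtom s v ∈ᶠ f
      bind-value {v} q = nth hs (# 22) (s ∷ x ∷ y ∷ c ∷ as ∷ v ∷ []) (node ∷ shape-complete x p tt ∷ q ∷ []) []

      bind-rest : ∀ i → atom 0 (cons (2 + i) s) 0 ∈ᶠ f
      bind-rest i = nth hs (# 23) (s ∷ x ∷ y ∷ c ∷ as ∷ i ∷ []) (node ∷ shape-complete x p tt ∷ []) []

  call-child : ∀ {s c o as} → callAtom s o c as ∈ᶠ f → ∀ n → atom 0 (cons n s) (pair c (cons o (cons (2 + n) as))) ∈ᶠ f
  call-child {s} {c} {o} {as} p n = nth hs (# 24) (s ∷ c ∷ o ∷ as ∷ n ∷ 0 ∷ []) (p ∷ []) []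

  unused-below : ∀ {s t} → atom 0 s 0 ∈ᶠ f → AtOrBelow s t → atom 0 t 0 ∈ᶠ f
  unused-below p (inj₁ refl)               = p
  unused-below p (inj₂ (one {i}))          = nth hs (# 25) (_ ∷ i ∷ 0 ∷ 0 ∷ 0 ∷ 0 ∷ []) (p ∷ []) []
  unused-below p (inj₂ (more {i} {t} q)) = nth hs (# 25) (t ∷ i ∷ 0 ∷ 0 ∷ 0 ∷ 0 ∷ []) (unused-below p (inj₂ q) ∷ []) []

-- The set of true facts

codeShape-injective : ∀ σ τ → codeShape σ ≡ codeShape τ → σ ≡ τ
codeShape-injective (leaf v) (leaf w) p = cong leaf (proj₂ (pair-injective p))
codeShape-injective (tail y) (tail z) p = cong tail (proj₂ (pair-injective p))
codeShape-injective (bind y c as) (bind z d bs) p with pair-injective (proj₂ (pair-injective p))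
... | refl , q with pair-injective q
... | refl , refl = refl
codeShape-injective (orac y c as) (orac z d bs) p with pair-injective (proj₂ (pair-injective p))
... | refl , q with pair-injective q
... | refl , refl = refl
codeShape-injective (leaf _) (tail _) p with () ← proj₁ (pair-injective p)
codeShape-injective (leaf _) (bind _ _ _) p with () ← proj₁ (pair-injective p)
codeShape-injective (leaf _) (orac _ _ _) p with () ← proj₁ (pair-injective p)
codeShape-injective (tail _) (leaf _) p with () ← proj₁ (pair-injective p)
codeShape-injective (tail _) (bind _ _ _) p with () ← proj₁ (pair-injective p)
codeShape-injective (tail _) (orac _ _ _) p with () ← proj₁ (pair-injective p)
codeShape-injective (bind _ _ _) (leaf _) p with () ← proj₁ (pair-injective p)
codeShape-injective (bind _ _ _) (tail _) p with () ← proj₁ (pair-injective p)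
codeShape-injective (bind _ _ _) (orac _ _ _) p with () ← proj₁ (pair-injective p)
codeShape-injective (orac _ _ _) (leaf _) p with () ← proj₁ (pair-injective p)
codeShape-injective (orac _ _ _) (tail _) p with () ← proj₁ (pair-injective p)
codeShape-injective (orac _ _ _) (bind _ _ _) p with () ← proj₁ (pair-injective p)

module Model (μ : Ty 2) (F : Ty 2) where
  open Derivations μ F

  Node : Set
  Node = Σ ℕ λ x → Σ ℕ λ v → Run x v

  child : Maybe Node → ℕ → Maybe Node
  child (just (_ , _ , tailR _ D))    0 = just (_ , _ , D)
  child (just (_ , _ , bindR _ D E))  0 = just (_ , _ , D)
  child (just (_ , _ , bindR _ D E))  1 = just (_ , _ , E)
  child (just (_ , _ , oracR g D))    i = just (_ , _ , D i)
  child _                             _ = nothing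

  tupleOf : Maybe Node → ℕ
  tupleOf nothing        = 0
  tupleOf (just (x , _)) = x

  valueOf : Maybe Node → Maybe ℕ
  valueOf nothing            = nothing
  valueOf (just (_ , v , _)) = just v

  shape≢ : ∀ {x σ τ} {A : Set} → σ ≢ τ → shape x ≡ just σ → shape x ≡ just τ → A
  shape≢ ne p q = ⊥-elim (ne (just-injective (trans (sym p) q)))

  -- The shape of the tuple tells which constructor built the run: any other would give it a
  -- different shape, and an empty node has tuple 0, which has none.
  leaf-node : ∀ m {v} → shape (tupleOf m) ≡ just (leaf v) → valueOf m ≡ just v × (∀ i → child m i ≡ nothing)
  leaf-node nothing p with () ← trans (sym shape-0) p
  leaf-node (just (x , v , leafR q)) p with refl ← trans (sym q) p = refl , λ i → refl
  leaf-node (just (x , v , tailR q D)) p = shape≢ (λ ()) q p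
  leaf-node (just (x , v , bindR q D E)) p = shape≢ (λ ()) q p
  leaf-node (just (_ , _ , oracR {o} {c} {as} g D)) p = shape≢ (λ ()) (shape-call c o as) p

  tail-node : ∀ m {y} → shape (tupleOf m) ≡ just (tail y) →
              tupleOf (child m 0) ≡ y × valueOf (child m 0) ≡ valueOf m × (∀ i → child m (suc i) ≡ nothing)
  tail-node nothing p with () ← trans (sym shape-0) p
  tail-node (just (x , v , leafR q)) p = shape≢ (λ ()) q p
  tail-node (just (x , v , tailR q D)) p with refl ← trans (sym q) p = refl , refl , λ i → refl
  tail-node (just (x , v , bindR q D E)) p = shape≢ (λ ()) q p
  tail-node (just (_ , _ , oracR {o} {c} {as} g D)) p = shape≢ (λ ()) (shape-call c o as) p

  bind-node : ∀ m {y c as} → shape (tupleOf m) ≡ just (bind y c as) →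
              tupleOf (child m 0) ≡ y ×
              (∀ w → valueOf (child m 0) ≡ just w → tupleOf (child m 1) ≡ pair c (cons (2 + w) as)) ×
              valueOf (child m 1) ≡ valueOf m × (∀ i → child m (2 + i) ≡ nothing)
  bind-node nothing p with () ← trans (sym shape-0) p
  bind-node (just (x , v , leafR q)) p = shape≢ (λ ()) q p
  bind-node (just (x , v , tailR q D)) p = shape≢ (λ ()) q p
  bind-node (just (x , v , bindR q D E)) p with refl ← trans (sym q) p = refl , (λ { w refl → refl }) , refl , λ i → refl
  bind-node (just (_ , _ , oracR {o} {c} {as} g D)) p = shape≢ (λ ()) (shape-call c o as) p

  call-node : ∀ m {c o as} → tupleOf m ≡ pair (pair 7 c) (cons o as) →
              Σ (ℕ → ℕ) λ g → Σ (∀ n → Run (pair c (cons o (cons (2 + n) as))) (g n)) λ D →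
              m ≡ just (_ , _ , oracR g D)
  call-node nothing {c} {o} {as} p with () ← trans (sym shape-0) (trans (cong shape p) (shape-call c o as))
  call-node (just (x , v , leafR q)) {c} {o} {as} refl = shape≢ (λ ()) q (shape-call c o as)
  call-node (just (x , v , tailR q D)) {c} {o} {as} refl = shape≢ (λ ()) q (shape-call c o as)
  call-node (just (x , v , bindR q D E)) {c} {o} {as} refl = shape≢ (λ ()) q (shape-call c o as)
  call-node (just (_ , _ , oracR g D)) p with pair-injective p
  ... | q , r with pair-injective q | pair-injective (suc-injective r)
  ... | _ , refl | refl , refl = g , D , refl

  unused-node : ∀ m → tupleOf m ≡ 0 → m ≡ nothing
  unused-node nothing p = refl
  unused-node (just (x , v , leafR q)) refl with () ← trans (sym shape-0) q
  unused-node (just (x , v , tailR q D)) refl with () ← trans (sym shape-0) q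
  unused-node (just (x , v , bindR q D E)) refl with () ← trans (sym shape-0) q
  unused-node (just (_ , _ , oracR {o} {c} {as} g D)) p
    with () ← trans (sym shape-0) (trans (cong shape (sym p)) (shape-call c o as))

  module _ (top : Node) where

    follow : List ℕ → Maybe Node
    follow []       = just top
    follow (i ∷ is) = child (follow is) i

    nodeAt : ℕ → Maybe Node
    nodeAt s = follow (dec s)

    nodeAt-root : nodeAt 0 ≡ just top
    nodeAt-root = cong follow (dec-enc [])

    nodeAt-child : ∀ i s → nodeAt (cons i s) ≡ child (nodeAt s) i
    nodeAt-child i s = cong follow (dec-cons i s)

    below? : List ℕ → ℕ → ℕ
    below? []       s = 0
    below? (i ∷ is) s with enc is ≟ s
    ... | yes _ = 1
    ... | no _  = below? is s

    -- The tables as partial functions, so that uniqueness of values holds by construction.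
    row : ℕ → ℕ → Maybe ℕ
    row 0 s = just (tupleOf (nodeAt s))
    row 1 s = valueOf (nodeAt s)
    row 2 x = Maybe.map codeShape (shape x)
    row 3 y = Maybe.map enc (pickList (proj₁ (unpair y)) (dec (proj₂ (unpair y))))
    row 4 y = just (enc (List.take (proj₁ (unpair y)) (dec (proj₂ (unpair y)))))
    row 5 y = just (below? (dec (proj₁ (unpair y))) (proj₂ (unpair y)))
    row _ _ = nothing

    entry : ℕ → Maybe ℕ
    entry r = row (proj₁ (unpair r)) (proj₂ (unpair r))

    facts : ℕ → ℕ
    facts n with Maybe.≡-dec _≟_ (entry (proj₁ (unpair n))) (just (proj₂ (unpair n)))
    ... | yes _ = 0
    ... | no _  = 1

    facts∈C : InC facts
    facts∈C n with Maybe.≡-dec _≟_ (entry (proj₁ (unpair n))) (just (proj₂ (unpair n)))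
    ... | yes _ = z≤n
    ... | no _  = s≤s z≤n

    fact⇒entry : ∀ r y → pair r y ∈ᶠ facts → entry r ≡ just y
    fact⇒entry r y p with Maybe.≡-dec _≟_ (entry (proj₁ (unpair (pair r y)))) (just (proj₂ (unpair (pair r y))))
    fact⇒entry r y p  | yes e rewrite unpair-pair r y = e
    fact⇒entry r y () | no _

    entry⇒fact : ∀ r y → entry r ≡ just y → pair r y ∈ᶠ facts
    entry⇒fact r y p with Maybe.≡-dec _≟_ (entry (proj₁ (unpair (pair r y)))) (just (proj₂ (unpair (pair r y))))
    ... | yes _ = refl
    ... | no ne rewrite unpair-pair r y = ⊥-elim (ne p)

    entry≡row : ∀ k x → entry (pair k x) ≡ row k x
    entry≡row k x rewrite unpair-pair k x = refl

    fact⇒ : ∀ k x y → atom k x y ∈ᶠ facts → row k x ≡ just y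
    fact⇒ k x y p = trans (sym (entry≡row k x)) (fact⇒entry (pair k x) y p)

    ⇒fact : ∀ k x y → row k x ≡ just y → atom k x y ∈ᶠ facts
    ⇒fact k x y p = entry⇒fact (pair k x) y (trans (entry≡row k x) p)

    fact⇒tuple : ∀ {s x} → atom 0 s x ∈ᶠ facts → tupleOf (nodeAt s) ≡ x
    fact⇒tuple p = just-injective (fact⇒ 0 _ _ p)

    tuple⇒fact : ∀ {s x} → tupleOf (nodeAt s) ≡ x → atom 0 s x ∈ᶠ facts
    tuple⇒fact p = ⇒fact 0 _ _ (cong just p)

    fact⇒shape : ∀ {s x} σ → atom 0 s x ∈ᶠ facts → atom 2 x (codeShape σ) ∈ᶠ facts → shape (tupleOf (nodeAt s)) ≡ just σ
    fact⇒shape {x = x} σ p q rewrite fact⇒tuple p with shape x | fact⇒ 2 x _ q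
    ... | just τ | r = cong just (codeShape-injective τ σ (just-injective r))

    shape⇒fact : ∀ {x} σ → shape x ≡ just σ → atom 2 x (codeShape σ) ∈ᶠ facts
    shape⇒fact {x} σ p = ⇒fact 2 x _ (cong (Maybe.map codeShape) p)

    child-tuple⇒fact : ∀ {s i x} → tupleOf (child (nodeAt s) i) ≡ x → atom 0 (cons i s) x ∈ᶠ facts
    child-tuple⇒fact {s} {i} p = tuple⇒fact (trans (cong tupleOf (nodeAt-child i s)) p)

    fact⇒child-value : ∀ {s i v} → valueAtom (cons i s) v ∈ᶠ facts → valueOf (child (nodeAt s) i) ≡ just v
    fact⇒child-value {s} {i} p = trans (cong valueOf (sym (nodeAt-child i s))) (fact⇒ 1 _ _ p)

    row-pick : ∀ i as → row 3 (pair i as) ≡ Maybe.map enc (pickList i (dec as))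
    row-pick i as rewrite unpair-pair i as = refl

    row-take : ∀ i as → row 4 (pair i as) ≡ just (enc (List.take i (dec as)))
    row-take i as rewrite unpair-pair i as = refl

    row-below : ∀ t s → row 5 (pair t s) ≡ just (below? (dec t) s)
    row-below t s rewrite unpair-pair t s = refl

    fact⇒pick : ∀ {i as l} → atom 3 (pair i as) l ∈ᶠ facts → pickList i (dec as) ≡ just (dec l)
    fact⇒pick {i} {as} {l} p with pickList i (dec as) | trans (sym (row-pick i as)) (fact⇒ 3 _ _ p)
    ... | just k | refl = cong just (sym (dec-enc k))

    fact⇒take : ∀ {i as l} → atom 4 (pair i as) l ∈ᶠ facts → List.take i (dec as) ≡ dec l
    fact⇒take {i} {as} p with trans (sym (row-take i as)) (fact⇒ 4 _ _ p)
    ... | refl = sym (dec-enc _)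

    -- In the order of `rules`. Clauses about codings are defining equations after decoding; clauses
    -- about the tree come from the lemmas on single nodes.
    facts-rules : All (Holds facts) (rules (proj₁ top))
    facts-rules =
        (λ { (r ∷ y ∷ y′ ∷ _) (p ∷ q ∷ []) (ne ∷ []) →
             ne (just-injective (trans (sym (fact⇒entry r y p)) (fact⇒entry r y′ q))) })
      ∷ (λ _ _ _ → tuple⇒fact (cong tupleOf nodeAt-root))
      ∷ (λ { (x ∷ as ∷ arg ∷ _) _ _ → shape⇒fact (leaf (suc x))
             (trans (shape-tuple 0 arg (cons (2 + x) as)) (cong (opShape 0 arg) (dec-cons (2 + x) as))) })
      ∷ (λ { (q ∷ as ∷ _) _ _ → shape⇒fact (leaf q) (shape-tuple 1 q as) })
      ∷ (λ { (x ∷ as ∷ arg ∷ _) _ _ → shape⇒fact (leaf x)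
             (trans (shape-tuple 2 arg (cons (2 + x) as)) (cong (opShape 2 arg) (dec-cons (2 + x) as))) })
      ∷ (λ { (c ∷ d ∷ as ∷ _) _ _ → shape⇒fact (bind (pair d as) c as) (trans (shape-tuple 3 (pair c d) as)
             (cong₂ (λ p l → just (bind (pair (proj₂ p) l) (proj₁ p) l)) (unpair-pair c d) (enc-dec as))) })
      ∷ (λ { (c ∷ d ∷ as ∷ _) _ _ → shape⇒fact (tail (pair c as)) (trans (shape-tuple 4 (pair c d) (cons 2 as))
             (trans (cong (opShape 4 (pair c d)) (dec-cons 2 as))
                    (cong₂ (λ p l → just (tail (pair (proj₁ p) l))) (unpair-pair c d) (enc-dec as)))) })
      ∷ (λ { (c ∷ d ∷ x ∷ as ∷ _) _ _ →
             shape⇒fact (bind (pair (pair 4 (pair c d)) (cons (2 + x) as)) d (cons (2 + x) as))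
               (trans (shape-tuple 4 (pair c d) (cons (3 + x) as)) (trans (cong (opShape 4 (pair c d)) (dec-cons (3 + x) as))
                 (cong₂ (λ p l → just (bind (pair (pair 4 (pair c d)) (cons (2 + x) l)) (proj₂ p) (cons (2 + x) l)))
                        (unpair-pair c d) (enc-dec as)))) })
      ∷ (λ { (i ∷ as ∷ l ∷ c ∷ _) (p ∷ []) _ → shape⇒fact (tail (pair c l)) (trans (shape-tuple 5 (pair i c) as)
             (trans (cong (λ p → Maybe.map (λ l → tail (pair (proj₂ p) (enc l))) (pickList (proj₁ p) (dec as))) (unpair-pair i c))
             (trans (cong (Maybe.map (λ l → tail (pair c (enc l)))) (fact⇒pick p))
                    (cong (λ l → just (tail (pair c l))) (enc-dec l))))) })
      ∷ (λ { (m ∷ as ∷ l ∷ c ∷ _) (p ∷ []) _ → shape⇒fact (tail (pair c l)) (trans (shape-tuple 8 m (cons (2 + c) as))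
             (trans (cong (opShape 8 m) (dec-cons (2 + c) as))
             (trans (cong (λ l → just (tail (pair c (enc l)))) (fact⇒take p)) (cong (λ l → just (tail (pair c l))) (enc-dec l))))) })
      ∷ (λ { (a ∷ as ∷ _) _ _ → ⇒fact 3 _ _ (trans (row-pick 0 (cons a as))
             (trans (cong (λ l → Maybe.map enc (pickList 0 l)) (dec-cons a as)) (cong (λ n → just (cons a n)) (enc-dec as)))) })
      ∷ (λ { (i ∷ as ∷ b ∷ bs ∷ a ∷ _) (p ∷ []) _ → ⇒fact 3 _ _ (trans (row-pick (suc i) (cons a as))
             (trans (cong (λ l → Maybe.map enc (pickList (suc i) l)) (dec-cons a as))
             (trans (cong (λ l → Maybe.map enc (pickMore a l)) (trans (fact⇒pick p) (cong just (dec-cons b bs))))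
                    (cong (λ n → just (cons b (cons a n))) (enc-dec bs))))) })
      ∷ (λ { (as ∷ _) _ _ → ⇒fact 4 _ _ (row-take 0 as) })
      ∷ (λ { (m ∷ _) _ _ → ⇒fact 4 _ _ (trans (row-take m 0) (cong just (trans (cong (λ l → enc (List.take m l)) (dec-enc []))
             (cong enc (take-[] m))))) })
      ∷ (λ { (m ∷ as ∷ l ∷ a ∷ _) (p ∷ []) _ → ⇒fact 4 _ _ (trans (row-take (suc m) (cons a as))
             (trans (cong (λ l → just (enc (List.take (suc m) l))) (dec-cons a as))
             (cong (λ n → just (cons a n)) (trans (cong enc (fact⇒take p)) (enc-dec l))))) })
      ∷ (λ { (s ∷ x ∷ v ∷ _) (p ∷ q ∷ []) _ → ⇒fact 1 _ _ (proj₁ (leaf-node (nodeAt s) (fact⇒shape (leaf v) p q))) })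
      ∷ (λ { (s ∷ x ∷ v ∷ i ∷ _) (p ∷ q ∷ []) _ →
             child-tuple⇒fact (cong tupleOf (proj₂ (leaf-node (nodeAt s) (fact⇒shape (leaf v) p q)) i)) })
      ∷ (λ { (s ∷ x ∷ y ∷ _) (p ∷ q ∷ []) _ → child-tuple⇒fact (proj₁ (tail-node (nodeAt s) (fact⇒shape (tail y) p q))) })
      ∷ (λ { (s ∷ x ∷ y ∷ v ∷ _) (p ∷ q ∷ r ∷ []) _ → ⇒fact 1 _ _
             (trans (sym (proj₁ (proj₂ (tail-node (nodeAt s) (fact⇒shape (tail y) p q))))) (fact⇒child-value r)) })
      ∷ (λ { (s ∷ x ∷ y ∷ i ∷ _) (p ∷ q ∷ []) _ →
             child-tuple⇒fact (cong tupleOf (proj₂ (proj₂ (tail-node (nodeAt s) (fact⇒shape (tail y) p q))) i)) })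
      ∷ (λ { (s ∷ x ∷ y ∷ c ∷ as ∷ _) (p ∷ q ∷ []) _ →
             child-tuple⇒fact (proj₁ (bind-node (nodeAt s) (fact⇒shape (bind y c as) p q))) })
      ∷ (λ { (s ∷ x ∷ y ∷ c ∷ as ∷ w ∷ _) (p ∷ q ∷ r ∷ []) _ → child-tuple⇒fact
             (proj₁ (proj₂ (bind-node (nodeAt s) (fact⇒shape (bind y c as) p q))) w (fact⇒child-value r)) })
      ∷ (λ { (s ∷ x ∷ y ∷ c ∷ as ∷ v ∷ _) (p ∷ q ∷ r ∷ []) _ → ⇒fact 1 _ _
             (trans (sym (proj₁ (proj₂ (proj₂ (bind-node (nodeAt s) (fact⇒shape (bind y c as) p q)))))) (fact⇒child-value r)) })
      ∷ (λ { (s ∷ x ∷ y ∷ c ∷ as ∷ i ∷ _) (p ∷ q ∷ []) _ → child-tuple⇒fact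
             (cong tupleOf (proj₂ (proj₂ (proj₂ (bind-node (nodeAt s) (fact⇒shape (bind y c as) p q)))) i)) })
      ∷ (λ { (s ∷ c ∷ o ∷ as ∷ n ∷ _) (p ∷ []) _ →
             child-tuple⇒fact (call-tuple n (proj₂ (proj₂ (call-node (nodeAt s) (fact⇒tuple p))))) })
      ∷ (λ { (s ∷ i ∷ _) (p ∷ []) _ →
             child-tuple⇒fact (cong (λ m → tupleOf (child m i)) (unused-node (nodeAt s) (fact⇒tuple p))) })
      ∷ (λ { (s ∷ _) _ _ → ⇒fact 5 _ _ (trans (row-below 0 s) (cong (λ l → just (below? l s)) (dec-enc []))) })
      ∷ (λ { (i ∷ s ∷ _) _ _ → ⇒fact 5 _ _ (trans (row-below (cons i s) s)
             (trans (cong (λ l → just (below? l s)) (dec-cons i s)) (cong just (below-one i s)))) })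
      ∷ (λ { (t ∷ s ∷ b ∷ i ∷ _) (p ∷ []) (ne ∷ []) → ⇒fact 5 _ _ (trans (row-below (cons i t) s)
             (trans (cong (λ l → just (below? l s)) (dec-cons i t))
             (trans (cong just (below-more i t s ne)) (trans (sym (row-below t s)) (fact⇒ 5 _ _ p))))) })
      ∷ []
      where
      take-[] : ∀ m → List.take {A = ℕ} m [] ≡ []
      take-[] zero    = refl
      take-[] (suc m) = refl

      call-tuple : ∀ {m c o as g D} n → m ≡ just (_ , _ , oracR {o} {c} {as} g D) →
                   tupleOf (child m n) ≡ pair c (cons o (cons (2 + n) as))
      call-tuple n refl = refl

      below-one : ∀ i s → below? (i ∷ dec s) s ≡ 1
      below-one i s with enc (dec s) ≟ s
      ... | yes _ = refl
      ... | no ne = ⊥-elim (ne (enc-dec s))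

      below-more : ∀ i t s → t ≢ s → below? (i ∷ dec t) s ≡ below? (dec t) s
      below-more i t s ne with enc (dec t) ≟ s
      ... | yes e = ⊥-elim (ne (trans (sym (enc-dec t)) e))
      ... | no _  = refl

-- Correctness of the extension

module _ {μ : Ty 2} (isμ : IsMu μ) where

  -- Number quantifiers over decidable properties are decided by `μ`, which takes the place of
  -- excluded middle when functions are compared.
  search : ∀ {P : ℕ → Set} → (∀ n → Dec (P n)) → Dec (Σ ℕ P)
  search {P} P? = go (P? (μ test))
    where
    test : ℕ → ℕ
    test n with P? n
    ... | yes _ = 0
    ... | no _  = 1
    ⇒test : ∀ n → P n → test n ≡ 0
    ⇒test n p with P? n
    ... | yes _ = refl
    ... | no ¬p = ⊥-elim (¬p p)
    test⇒ : ∀ n → test n ≡ 0 → P n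
    test⇒ n e with P? n
    ... | yes p = p
    go : Dec (P (μ test)) → Dec (Σ ℕ P)
    go (yes p) = yes (_ , p)
    go (no ¬p) = no λ { (n , p) → ¬p (test⇒ _ (μ-zero isμ test n (⇒test n p))) }

  _≗?_ : (g h : ℕ → ℕ) → Dec (g ≗ h)
  g ≗? h with search (λ n → ¬? (g n ≟ h n))
  ... | yes (n , ne) = no λ e → ne (e n)
  ... | no none      = yes λ n → decidable-stable (g n ≟ h n) (λ ne → none (n , ne))

module Extension (μ : Ty 2) (isμ : IsMu μ) (F : Ty 2) (top : Model.Node μ F) where
  open Derivations μ F
  open Model μ F

  -- F need not be extensional, so it is applied to the very function used in the given computation whenever that
  -- function is pointwise equal to h.
  represent : Maybe Node → Ty 1 → Ty 1
  represent (just (_ , _ , oracR g _)) h with _≗?_ isμ h g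
  ... | yes _ = g
  ... | no _  = h
  represent _ h = h

  choose : ℕ → Ty 1 → Ty 1
  choose s h = represent (nodeAt top s) h

  represent-≗ : ∀ m h → represent m h ≗ h
  represent-≗ nothing                      h x = refl
  represent-≗ (just (_ , _ , leafR _))     h x = refl
  represent-≗ (just (_ , _ , tailR _ _))   h x = refl
  represent-≗ (just (_ , _ , bindR _ _ _)) h x = refl
  represent-≗ (just (_ , _ , oracR g _))   h x with _≗?_ isμ h g
  ... | yes e = sym (e x)
  ... | no _  = refl

  choose-≗ : ∀ s h → choose s h ≗ h
  choose-≗ s = represent-≗ (nodeAt top s)

  represent≡ : ∀ {o c as g D} h → h ≗ g → represent (just (_ , _ , oracR {o} {c} {as} g D)) h ≡ g
  represent≡ {g = g} h e with _≗?_ isμ h g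
  ... | yes _ = refl
  ... | no ne = ⊥-elim (ne e)

  open Errors μ isμ F choose

  module _ {f : ℕ → ℕ} {root : ℕ} (hs : All (Holds f) (rules root)) where
    open Laws hs

    NoMinBad : ℕ → Set
    NoMinBad s = ∀ t → AtOrBelow s t → ∀ o c as → ¬ MinBad f t o c as

    -- The second half strengthens the induction: at an S8 node it shows that a bad node would be
    -- minimal bad.
    Correct : ℕ → ℕ → Set
    Correct s v = valueAtom s v ∈ᶠ f × (∀ t → AtOrBelow s t → NoBad f t)

    no-min-child : ∀ {s i} → NoMinBad s → NoMinBad (cons i s)
    no-min-child nm t b = nm t (inj₂ (child-below b))

    not-call : ∀ {s x σ} → atom 0 s x ∈ᶠ f → shape x ≡ just σ → NonCall σ → NoBad f s
    not-call {s} {x} {σ} node p nc o c as (call , _) with unique (pair 0 s) node call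
    ... | refl with trans (sym p) (shape-call c o as)
    ... | refl = nc

    -- All positions below carry the tuple 0, which has no shape, while an S8 call has one.
    unused-good : ∀ {s} → atom 0 s 0 ∈ᶠ f → ∀ t → AtOrBelow s t → NoBad f t
    unused-good p t b o c as (call , _) with unique (pair 0 t) (unused-below p b) call
    ... | e with trans (sym shape-0) (trans (cong shape e) (shape-call c o as))
    ... | ()

    good-below : ∀ {s} → NoBad f s → (∀ i t → AtOrBelow (cons i s) t → NoBad f t) → ∀ t → AtOrBelow s t → NoBad f t
    good-below self rest t (inj₁ refl) = self
    good-below self rest t (inj₂ b) with below-child b
    ... | i , c = rest i t c

    childValue≗ : ∀ {s g} → (∀ n → valueAtom (cons n s) (g n) ∈ᶠ f) → childValue f s ≗ g
    childValue≗ {s} {g} p n = unique (pair 1 (cons n s))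
      (μ-zero isμ (λ y → f (valueAtom (cons n s) y)) (g n) (p n)) (p n)

    -- `μ` respects pointwise equality, and for `F` the representative of the claimed values is `g`
    -- itself.
    answer≡ : ∀ {s o c as g D} → nodeAt top s ≡ just (_ , _ , oracR {o} {c} {as} g D) →
              (∀ n → valueAtom (cons n s) (g n) ∈ᶠ f) → answer f s o ≡ oracle o g
    answer≡ {s} {zero}  {D = D} e p =
      cong F (trans (cong (λ m → represent m (childValue f s)) e) (represent≡ {D = D} _ (childValue≗ p)))
    answer≡ {s} {suc o} e p = μ-ext isμ (childValue≗ p)

    -- Induction on the run. At an S8 node the children are correct, so the oracle's answer to their
    -- claimed values is the true one. If `f` lacked it, the node would be bad with nothing bad
    -- below, hence minimal bad.
    correct : ∀ {x v} (D : Run x v) s → nodeAt top s ≡ just (x , v , D) → atom 0 s x ∈ᶠ f → NoMinBad s → Correct s v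
    correct (leafR p) s e node nm =
      leaf-value node p ,
      good-below (not-call node p tt) (λ i → unused-good (leaf-rest node p i))
    correct (tailR p D) s e node nm
      with correct D (cons 0 s) (trans (nodeAt-child top 0 s) (cong (λ m → child m 0) e)) (tail-child node p) (no-min-child nm)
    ... | q , good = tail-value node p q , good-below (not-call node p tt) rest
      where
      rest : ∀ i t → AtOrBelow (cons i s) t → NoBad f t
      rest zero    = good
      rest (suc i) = unused-good (tail-rest node p i)
    correct (bindR p D E) s e node nm
      with correct D (cons 0 s) (trans (nodeAt-child top 0 s) (cong (λ m → child m 0) e)) (bind-first node p) (no-min-child nm)
    ... | q , good₀
      with correct E (cons 1 s) (trans (nodeAt-child top 1 s) (cong (λ m → child m 1) e)) (bind-second node p q) (no-min-child nm)
    ... | r , good₁ = bind-value node p r , good-below (not-call node p tt) rest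
      where
      rest : ∀ i t → AtOrBelow (cons i s) t → NoBad f t
      rest zero          = good₀
      rest (suc zero)    = good₁
      rest (suc (suc i)) = unused-good (bind-rest node p i)
    correct (oracR {o} {c} {as} g D) s e node nm = value , good-below self (λ n → proj₂ (children n))
      where
      children : ∀ n → Correct (cons n s) (g n)
      children n = correct (D n) (cons n s) (trans (nodeAt-child top n s) (cong (λ m → child m n) e))
                     (call-child node n) (no-min-child nm)
      ans : answer f s o ≡ oracle o g
      ans = answer≡ e (λ n → proj₁ (children n))
      noneBelow : ∀ t → belowAtom t s ∈ᶠ f → NoBad f t
      noneBelow t b with below-child (below-sound b)
      ... | n , t≤n = proj₂ (children n) t t≤n
      value : valueAtom s (oracle o g) ∈ᶠ f
      value with f (valueAtom s (oracle o g)) ≟ 0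
      ... | yes p = p
      ... | no np = ⊥-elim (nm s (inj₁ refl) o c as
                      ((node , λ a → np (subst (λ v → valueAtom s v ∈ᶠ f) ans a)) , noneBelow))
      self : NoBad f s
      self o′ c′ as′ (call , wrong) with pair-injective (unique (pair 0 s) node call)
      ... | _ , q with pair-injective (suc-injective q)
      ... | refl , _ = wrong (subst (λ v → valueAtom s v ∈ᶠ f) (sym ans) value)

    -- Below a minimal bad node `correct` applies to the children. If the node truly is this call,
    -- they have their true values, so the answer computed from `f` is the true value of the node;
    -- agreement on that fact contradicts badness.
    minBad-refuted : ∀ {s o c as} → MinBad f s o c as → callAtom s o c as ∈ᶠ facts top →
                     (valueAtom s (answer f s o) ∈ᶠ facts top → valueAtom s (answer f s o) ∈ᶠ f) → ⊥
    minBad-refuted {s} {o} {c} {as} ((call , wrong) , least) call′ agree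
      with call-node (nodeAt top s) (fact⇒tuple top call′)
    ... | g , D , e = wrong (agree (⇒fact top 1 s _ (trans (cong valueOf e) (cong just (sym (answer≡ e values))))))
      where
      values : ∀ n → valueAtom (cons n s) (g n) ∈ᶠ f
      values n = proj₁ (correct (D n) (cons n s) (trans (nodeAt-child top n s) (cong (λ m → child m n) e))
        (call-child call n) (λ t b o′ c′ as′ m → least t (below-complete (child-below b)) o′ c′ as′ (proj₁ m)))

  root : ℕ
  root = proj₁ top

  result : ℕ
  result = proj₁ (proj₂ top)

  right-value : ∀ {f} → Right (rules root) f → valueAtom 0 result ∈ᶠ f
  right-value (hs , nm) =
    proj₁ (correct hs (proj₂ (proj₂ top)) 0 (nodeAt-root top) (Laws.root-node hs) (λ t _ → nm t))

  indicator : ℕ → (ℕ → ℕ) → ℕ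
  indicator n g with _≗?_ isμ g (facts top)
  ... | yes _ = n
  ... | no _  = 0

  indicator-facts : ∀ n → indicator n (facts top) ≡ n
  indicator-facts n with _≗?_ isμ (facts top) (facts top)
  ... | yes _ = refl
  ... | no ne = ⊥-elim (ne λ _ → refl)

  -- Without an error `f` gives `result` to the root and the modulus is `n`. With one, the true
  -- facts agree with `f` below the bound, which refutes either kind of error.
  facts-modulus : ∀ n f → Ext f (modulus (rules root) result n f) (facts top) → n ≤ modulus (rules root) result n f
  facts-modulus n f ext with modulus-cases (rules root) result n f
  ... | inj₂ (none , p) = ≤-reflexive (sym (trans p (cong (λ a → recℕ a n (λ _ _ → 0)) (right-value (no-error (rules root) none)))))
  ... | inj₁ (e , p) with error⇒ (rules root) e
  ... | inj₁ refute = ⊥-elim (refute (facts top) (λ i l → ext i (subst (i <_) (sym p) l)) (facts-rules top))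
  ... | inj₂ (hs , s , o , c , as , m , k , l) =
    ⊥-elim (minBad-refuted hs m (trans (ext _ (subst (_ <_) (sym p) k)) (proj₁ (proj₁ m)))
      (λ q → trans (sym (ext _ (subst (_ <_) (sym p) l))) q))

  module _ {M : Ty 3} (pincherle : Pincherle M) where

    result-large : ∀ n → n ≤ M (modulus (rules root) result n)
    result-large n = subst (_≤ M (modulus (rules root) result n)) (indicator-facts n)
      (pincherle (indicator n) (modulus (rules root) result n) loc (facts top) (facts∈C top))
      where
      loc : LOC (indicator n) (modulus (rules root) result n)
      loc f g _ _ ext with _≗?_ isμ g (facts top)
      ... | no _  = z≤n
      ... | yes e = facts-modulus n f (λ i l → trans (sym (e i)) (ext i l))

  -- A right `f` gives `result` to the root, and values are unique, so it cannot also give `w`.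
  other-const : ∀ {w} → w ≢ result → ∀ m n f → modulus (rules root) w m f ≡ modulus (rules root) w n f
  other-const ne m n f = modulus-const (rules root) _ m n f
    (λ r p → ne (Laws.unique (proj₁ r) (pair 1 0) p (right-value r)))

-- The code of the extension and its value

boxCode : List Rule → Code
-- `M` is at place 3, behind `n`, `w` and `F`. Its argument `f` arrives in front and `sink 2` puts
-- it behind `n` and `w`; `s2 0` is a placeholder for the code of `box`.
boxCode rs = call 3 (sink 2 (compile (s2 0) (modulusE rs)))

extension : Code → Code
-- 0 and 1 are the symbols for the arguments `F` and `μ`.
extension e₀ = compile (boxCode (rules (tuple e₀ (0 ∷ 1 ∷ [])))) leastE

extension-PrimRec : ∀ e₀ → PrimRec (extension e₀)
extension-PrimRec e₀ = compile-PrimRec {κ = boxCode rs}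
  (PrimRec-call 3 {sink 2 body} (PrimRec-rotate 2 2 {body} (compile-PrimRec {κ = s2 0} tt (modulusE rs)))) leastE
  where
  rs : List Rule
  rs = rules (tuple e₀ (0 ∷ 1 ∷ []))
  body : Code
  body = compile (s2 0) (modulusE rs)

module _ {μ : Ty 2} (M : Ty 3) {F : Ty 2} {choose : ℕ → Ty 1 → Ty 1} (choose-≗ : ∀ s h → choose s h ≗ h) where
  open Semantics μ F choose
  open Soundness M choose-≗

  -- S8 lets `M` be applied to any `G` pointwise equal to the modulus. For `w` other than the value
  -- of the computation, one `G` can thus serve all `n`.
  box-sound : ∀ {rs n w} (G : Ty 2) → (∀ f → eval (modulusE rs) f (n ∷ w ∷ []) ≡ G f) → ∀ B →
              Comp (boxCode rs) (stack (n ∷ w ∷ []) (functionals false B)) (M G)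
  box-sound {rs} {n} {w} G e B = call-comp refl G (λ f →
    sink-comp refl (subst (Comp _ _) (e f) (sound f tt (modulusE rs) (n ∷ w ∷ []))))

theorem3p3 : (e₀ : Code) →
    Σ Code (λ d → PrimRec d ×
    ((μ : Ty 2) → IsMu μ → (M : Ty 3) → Pincherle M → (F : Ty 2) →
    (Σ ℕ (λ n → Comp d ((2 , F) ∷ (3 , M) ∷ (2 , μ) ∷ []) n))
    × ((v : ℕ) → Comp e₀ ((2 , F) ∷ (2 , μ) ∷ []) v →
    Comp d ((2 , F) ∷ (3 , M) ∷ (2 , μ) ∷ []) v)))
theorem3p3 e₀ = extension e₀ , extension-PrimRec e₀ , λ μ isμ M pincherle F →
  total μ M F , extends μ isμ M pincherle F
  where
  rs : List Rule
  rs = rules (tuple e₀ (0 ∷ 1 ∷ []))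

  -- With no computation to match, every function represents itself.
  total : ∀ μ M F → Σ ℕ (λ n → Comp (extension e₀) ((2 , F) ∷ (3 , M) ∷ (2 , μ) ∷ []) n)
  total μ M F = _ , sound B (λ n w → box-sound M (λ _ _ _ → refl) {rs} (G n w) (λ _ → refl) B) leastE []
    where
    open Semantics μ F (λ _ h → h)
    open Soundness M (λ _ _ _ → refl)
    G : ℕ → ℕ → Ty 2
    G n w f = eval (modulusE rs) f (n ∷ w ∷ [])
    B : ℕ → ℕ → ℕ
    B n w = M (G n w)

  extends : ∀ μ → IsMu μ → ∀ M → Pincherle M → ∀ F v → Comp e₀ ((2 , F) ∷ (2 , μ) ∷ []) v →
            Comp (extension e₀) ((2 , F) ∷ (3 , M) ∷ (2 , μ) ∷ []) v
  extends μ isμ M pincherle F v p = subst (Comp _ _) value (sound B runs leastE [])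
    where
    open Extension μ isμ F (_ , v , Derivations.toRun μ F p (0 ∷ 1 ∷ []) refl)
    open Semantics μ F choose
    open Soundness M choose-≗
    open Truth μ isμ F choose
    open Errors μ isμ F choose

    -- For w ≠ v the functions modulus rs w n agree pointwise for all n, and M is applied to the one with n = 0.
    B : ℕ → ℕ → ℕ
    B n w with w ≟ v
    ... | yes _ = M (modulus rs w n)
    ... | no _  = M (modulus rs w 0)

    runs : ∀ n w → Comp (boxCode rs) (stack (n ∷ w ∷ []) (functionals false B)) (B n w)
    runs n w with w ≟ v
    ... | yes _ = box-sound M choose-≗ {rs} (modulus rs w n) (λ _ → refl) B
    ... | no ne = box-sound M choose-≗ {rs} (modulus rs w 0) (other-const ne n 0) B

    B-large : ∀ n → n ≤ B n v
    B-large n with v ≟ v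
    ... | yes _ = result-large pincherle n
    ... | no ne = ⊥-elim (ne refl)

    B-const : ∀ {w} → w ≢ v → ∀ m n → B m w ≡ B n w
    B-const {w} ne m n with w ≟ v
    ... | yes e = ⊥-elim (ne e)
    ... | no _  = refl

    small : Exp false 2
    small = leE (sc box) (var (# 0))

    unbounded : True (notE (exE small)) B (v ∷ [])
    unbounded = ⇒not (exE small) λ t → let n , q = ex⇒ small t in
      <⇒≱ (le⇒ (sc box) (var (# 0)) q) (B-large n)

    bounded : ∀ w → w ≢ v → ¬ True (notE (exE small)) B (w ∷ [])
    -- All `B n w` equal `B 0 w`, so `suc (B 0 w)` is an `n` that exceeds the value of `M`.
    bounded w ne z = not⇒ (exE small) z (⇒ex small (suc (B 0 w))
      (⇒le (sc box) (var (# 0)) (s≤s (≤-reflexive (B-const ne _ 0)))))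

    value : eval leastE B [] ≡ v
    value = μ-least isμ _ v (isTrue unbounded) (λ w w<v z → bounded w (<⇒≢ w<v) (by z))
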